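{- Let $n\in\mathbb{N}$, $n>1$, let $f\in\mathcal{A}$, and put $g=e^{f}\in\mathcal{M}$ and $h=e^{ -f}\in\mathcal{I}_0$ (pointwise). Then the preorders on $\mathbb{Z}$ induced by $d^{(n)}_{(f,+)}$, $d^{(n)}_{(g,+)}$, $d^{(n)}_{(h,+)}$ and $d^{(n)}_{(h,\cdot)}$ are equivalent, i.e. for all $x,y\in\mathbb{Z}$, $$x\preceq_{d^{(n)}_{(f,+)}}y\iff x\preceq_{d^{(n)}_{(g,+)}}y\iff x\preceq_{d^{(n)}_{(h,+)}}y\iff x\preceq_{d^{(n)}_{(h,\cdot)}}y.$$ Furthermore, for every $h_0\in\mathcal{I}\setminus\mathcal{I}_0$ and all $x,y\in\mathbb{Z}$, $$x\preceq_{d^{(n)}_{(h_0,+)}}y\iff x\preceq_{d^{(n)}_{(h_0,\cdot)}}y.$$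
   Context: $\mathbb{N}$ is the set of positive integers. A function $f:\mathbb{N}\to\mathbb{R}$ is additive if $f(xy)=f(x)+f(y)$ for all coprime $x,y$; $g:\mathbb{N}\to\mathbb{R}$ is multiplicative if $g$ is not identically zero and $g(xy)=g(x)g(y)$ for all coprime $x,y$. With inequalities required for all $x\in\mathbb{N}$, $x>1$: $\mathcal{A}=\{f\text{ additive}: f(x)\ge0\}$, $\mathcal{M}=\{g\text{ multiplicative}: g(x)\ge1\}$, $\mathcal{I}=\{h\text{ multiplicative}: 0\le h(x)\le1\}$, $\mathcal{I}_0=\{h\in\mathcal{I}: 0<h(x)\le1\}$. The following pseudometrics on $\mathbb{Z}$ are $0$ when $x=y$, and for $x\ne y$ are given by $d^{(n)}_{(f,+)}(x,y)=f(\gcd(x,n))+f(\gcd(y,n))$ for $f\in\mathcal{A}$, $d^{(n)}_{(g,+)}(x,y)=g(\gcd(x,n))+g(\gcd(y,n))-2$ for $g\in\mathcal{M}$, $d^{(n)}_{(h,+)}(x,y)=2-h(\gcd(x,n))-h(\gcd(y,n))$ and $d^{(n)}_{(h,\cdot)}(x,y)=1-h(\gcd(x,n))\cdot h(\gcd(y,n))$ for $h\in\mathcal{I}$. The preorder induced by a pseudometric $d$ on $\mathbb{Z}$ is $x\preceq_d y\iff d(1,x)\le d(1,y)$. -}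

module Defs where

open import Data.Nat.Base as ℕ using (ℕ; zero; suc; NonZero)
import Data.Nat.Properties as ℕ
open import Data.Nat.GCD using (gcd; gcd[m,n]≢0)
open import Data.Nat.Coprimality using (Coprime)
open import Data.Integer.Base as ℤ using (ℤ; +_; -[1+_]; ∣_∣)
import Data.Integer.Properties as ℤ
open import Data.Rational.Base as ℚ using (ℚ; mkℚ; 0ℚ; 1ℚ; ½)
import Data.Rational.Properties as ℚ
open import Data.Rational.Solver using (module +-*-Solver)
import Data.Rational.Unnormalised.Base as ℚᵘ
import Data.Rational.Unnormalised.Properties as ℚᵘ
open import Data.Product.Base using (Σ; ∃; ∃₂; _×_; _,_; proj₁; proj₂)
open import Data.Sum.Base using (inj₁; inj₂)
open import Relation.Nullary using (¬_; yes; no)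
open import Relation.Binary.PropositionalEquality

open +-*-Solver using (solve; con; _:+_; _:*_; _:-_; :-_; _:=_)
open ℚ.≤-Reasoning

module ℚFacts where
  nat : ℕ → ℚ
  nat a = + a ℚ./ 1

  unit : ℕ → ℚ
  unit k = + 1 ℚ./ suc k

  0<unit : ∀ k → 0ℚ ℚ.< unit k
  0<unit k = ℚ.positive⁻¹ (unit k) {{ℚ.normalize-pos 1 (suc k)}}

  0≤nat : ∀ a → 0ℚ ℚ.≤ nat a
  0≤nat a = ℚ.nonNegative⁻¹ (nat a) {{ℚ.normalize-nonNeg a 1}}

  ≤nat : ∀ p → ∃ λ a → p ℚ.≤ nat a
  ≤nat p@(mkℚ n d _) = ∣ n ∣ , ℚ.toℚᵘ-cancel-≤
    (ℚᵘ.≤-respʳ-≃ (ℚᵘ.≃-sym (ℚ.toℚᵘ-fromℚᵘ (ℚᵘ.mkℚᵘ (+ ∣ n ∣) 0)))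
      (ℚᵘ.*≤* (ℤ.≤-trans (ℤ.≤-reflexive (ℤ.*-identityʳ n)) (bound n))))
    where
    bound : ∀ i → i ℤ.≤ + ∣ i ∣ ℤ.* + suc d
    bound (+ m) = ℤ.≤-trans (ℤ.+≤+ (ℕ.m≤m*n m (suc d))) (ℤ.≤-reflexive (ℤ.pos-* m (suc d)))
    bound -[1+ m ] = ℤ.-≤+

  unit≤ : ∀ ε → 0ℚ ℚ.< ε → ∃ λ d → unit d ℚ.≤ ε
  unit≤ (mkℚ (+ zero) d c) 0<ε with ℚ.drop-*<* 0<ε
  ... | ℤ.+<+ ()
  unit≤ (mkℚ -[1+ n ] d c) 0<ε with ℚ.drop-*<* 0<ε
  ... | ()
  unit≤ ε@(mkℚ (+ suc n) d _) _ = d , ℚ.toℚᵘ-cancel-≤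
    (ℚᵘ.≤-respˡ-≃ (ℚᵘ.≃-sym (ℚ.toℚᵘ-fromℚᵘ (ℚᵘ.mkℚᵘ (+ 1) d)))
      (ℚᵘ.*≤* (ℤ.*-monoʳ-≤-nonNeg (+ suc d) {+ 1} {+ suc n} (ℤ.+≤+ (ℕ.s≤s ℕ.z≤n)))))

  nat*unit≤unit : ∀ a d k → a ℕ.* suc d ℕ.≤ suc k → nat a ℚ.* unit k ℚ.≤ unit d
  nat*unit≤unit a d k le = ℚ.toℚᵘ-cancel-≤
    (ℚᵘ.≤-respʳ-≃ (ℚᵘ.≃-sym (ℚ.toℚᵘ-fromℚᵘ (ℚᵘ.mkℚᵘ (+ 1) d)))
    (ℚᵘ.≤-respˡ-≃ (ℚᵘ.≃-sym (ℚᵘ.≃-trans (ℚ.toℚᵘ-homo-* (nat a) (unit k))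
        (ℚᵘ.*-cong (ℚ.toℚᵘ-fromℚᵘ (ℚᵘ.mkℚᵘ (+ a) 0)) (ℚ.toℚᵘ-fromℚᵘ (ℚᵘ.mkℚᵘ (+ 1) k)))))
      (ℚᵘ.*≤* (subst₂ ℤ._≤_ lhs rhs (ℤ.+≤+ le)))))
    where
    lhs : + (a ℕ.* suc d) ≡ (+ a ℤ.* + 1) ℤ.* + suc d
    lhs = trans (ℤ.pos-* a (suc d)) (cong (ℤ._* + suc d) (sym (ℤ.*-identityʳ (+ a))))
    rhs : + suc k ≡ + 1 ℤ.* (+ 1 ℤ.* + suc k)
    rhs = sym (trans (ℤ.*-identityˡ _) (ℤ.*-identityˡ _))

  *-monoˡ : ∀ {r p q} → 0ℚ ℚ.≤ r → p ℚ.≤ q → r ℚ.* p ℚ.≤ r ℚ.* q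
  *-monoˡ {r} 0≤r = ℚ.*-monoˡ-≤-nonNeg r {{ℚ.nonNegative 0≤r}}

  *-monoʳ : ∀ {r p q} → 0ℚ ℚ.≤ r → p ℚ.≤ q → p ℚ.* r ℚ.≤ q ℚ.* r
  *-monoʳ {r} 0≤r = ℚ.*-monoʳ-≤-nonNeg r {{ℚ.nonNegative 0≤r}}

  0≤* : ∀ {p q} → 0ℚ ℚ.≤ p → 0ℚ ℚ.≤ q → 0ℚ ℚ.≤ p ℚ.* q
  0≤* {p} {q} 0≤p 0≤q = subst (ℚ._≤ p ℚ.* q) (ℚ.*-zeroʳ p) (*-monoˡ 0≤p 0≤q)

  *-mono : ∀ {p p′ q q′} → 0ℚ ℚ.≤ p → 0ℚ ℚ.≤ q′ → p ℚ.≤ p′ → q ℚ.≤ q′ → p ℚ.* q ℚ.≤ p′ ℚ.* q′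
  *-mono 0≤p 0≤q′ p≤p′ q≤q′ = ℚ.≤-trans (*-monoˡ 0≤p q≤q′) (*-monoʳ 0≤q′ p≤p′)

  0≤+ : ∀ {p q} → 0ℚ ℚ.≤ p → 0ℚ ℚ.≤ q → 0ℚ ℚ.≤ p ℚ.+ q
  0≤+ = ℚ.+-mono-≤

  scale : ∀ B ε → 0ℚ ℚ.< ε → ∃ λ K → ∀ k → K ℕ.≤ k → B ℚ.* unit k ℚ.≤ ε
  scale B ε 0<ε = let a , B≤a = ≤nat B ; d , u≤ε = unit≤ ε 0<ε in
    a ℕ.* suc d , λ k K≤k →
      ℚ.≤-trans (*-monoʳ (ℚ.<⇒≤ (0<unit k)) B≤a)
        (ℚ.≤-trans (nat*unit≤unit a d k (ℕ.≤-trans K≤k (ℕ.n≤1+n k))) u≤ε)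

  half : ℚ → ℚ
  half ε = ½ ℚ.* ε

  0<half : ∀ {ε} → 0ℚ ℚ.< ε → 0ℚ ℚ.< half ε
  0<half {ε} 0<ε = subst (ℚ._< half ε) (ℚ.*-zeroʳ ½) (ℚ.*-monoʳ-<-pos ½ 0<ε)

  half+half : ∀ ε → half ε ℚ.+ half ε ≡ ε
  half+half = solve 1 (λ e → con ½ :* e :+ con ½ :* e := e) refl

  ∣p-q∣-sym : ∀ p q → ℚ.∣ p ℚ.- q ∣ ≡ ℚ.∣ q ℚ.- p ∣
  ∣p-q∣-sym p q = trans (cong ℚ.∣_∣ (solve 2 (λ p q → p :- q := :- (q :- p)) refl p q))
                        (ℚ.∣-p∣≡∣p∣ (q ℚ.- p))

  ∣p-r∣≤ : ∀ p q r → ℚ.∣ p ℚ.- r ∣ ℚ.≤ ℚ.∣ p ℚ.- q ∣ ℚ.+ ℚ.∣ q ℚ.- r ∣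
  ∣p-r∣≤ p q r = subst (λ s → ℚ.∣ s ∣ ℚ.≤ ℚ.∣ p ℚ.- q ∣ ℚ.+ ℚ.∣ q ℚ.- r ∣)
    (solve 3 (λ p q r → (p :- q) :+ (q :- r) := p :- r) refl p q r)
    (ℚ.∣p+q∣≤∣p∣+∣q∣ (p ℚ.- q) (q ℚ.- r))

open ℚFacts

-- Real numbers are Cauchy sequences of rationals.  Distinct sequences may
-- represent the same real, so equality is _≈_, never _≡_.

CauchySeq : (ℕ → ℚ) → Set
CauchySeq s = ∀ ε → 0ℚ ℚ.< ε → ∃ λ N → ∀ m n → N ℕ.≤ m → N ℕ.≤ n → ℚ.∣ s m ℚ.- s n ∣ ℚ.< ε

record ℝ : Set where
  constructor mkℝ
  field
    seq    : ℕ → ℚ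
    cauchy : CauchySeq seq

open ℝ public

infix 4 _≈_ _≤_ _<_

_≈_ : ℝ → ℝ → Set
x ≈ y = ∀ ε → 0ℚ ℚ.< ε → ∃ λ N → ∀ n → N ℕ.≤ n → ℚ.∣ seq x n ℚ.- seq y n ∣ ℚ.< ε

_≤_ : ℝ → ℝ → Set
x ≤ y = ∀ ε → 0ℚ ℚ.< ε → ∃ λ N → ∀ n → N ℕ.≤ n → seq x n ℚ.< seq y n ℚ.+ ε

_<_ : ℝ → ℝ → Set
x < y = ∃ λ ε → 0ℚ ℚ.< ε × ∃ λ N → ∀ n → N ℕ.≤ n → seq x n ℚ.+ ε ℚ.< seq y n

fromℚ : ℚ → ℝ
seq    (fromℚ q) _ = q
cauchy (fromℚ q) ε 0<ε = 0 , λ _ _ _ _ →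
  subst (ℚ._< ε) (sym (cong ℚ.∣_∣ (ℚ.+-inverseʳ q))) 0<ε

0ℝ 1ℝ 2ℝ : ℝ
0ℝ = fromℚ 0ℚ
1ℝ = fromℚ 1ℚ
2ℝ = fromℚ (1ℚ ℚ.+ 1ℚ)

infixl 6 _+_ _-_
infixl 7 _*_
infix  8 -_

_+_ : ℝ → ℝ → ℝ
seq    (x + y) n = seq x n ℚ.+ seq y n
cauchy (x + y) ε 0<ε =
  let M , hx = cauchy x (half ε) (0<half 0<ε)
      N , hy = cauchy y (half ε) (0<half 0<ε)
  in M ℕ.⊔ N , λ m n le le′ →
    begin-strict
    ℚ.∣ (seq x m ℚ.+ seq y m) ℚ.- (seq x n ℚ.+ seq y n) ∣
      ≡⟨ cong ℚ.∣_∣ (solve 4 (λ a b c d → (a :+ b) :- (c :+ d) := (a :- c) :+ (b :- d)) refl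
           (seq x m) (seq y m) (seq x n) (seq y n)) ⟩
    ℚ.∣ (seq x m ℚ.- seq x n) ℚ.+ (seq y m ℚ.- seq y n) ∣
      ≤⟨ ℚ.∣p+q∣≤∣p∣+∣q∣ (seq x m ℚ.- seq x n) (seq y m ℚ.- seq y n) ⟩
    ℚ.∣ seq x m ℚ.- seq x n ∣ ℚ.+ ℚ.∣ seq y m ℚ.- seq y n ∣
      <⟨ ℚ.+-mono-< (hx m n (ℕ.m⊔n≤o⇒m≤o M N le) (ℕ.m⊔n≤o⇒m≤o M N le′))
                    (hy m n (ℕ.m⊔n≤o⇒n≤o M N le) (ℕ.m⊔n≤o⇒n≤o M N le′)) ⟩
    half ε ℚ.+ half ε ≡⟨ half+half ε ⟩
    ε ∎

-_ : ℝ → ℝ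
seq    (- x) n = ℚ.- seq x n
cauchy (- x) ε 0<ε = let N , h = cauchy x ε 0<ε in N , λ m n le le′ →
  subst (ℚ._< ε)
    (trans (sym (ℚ.∣-p∣≡∣p∣ (seq x m ℚ.- seq x n)))
           (cong ℚ.∣_∣ (solve 2 (λ a b → :- (a :- b) := :- a :- (:- b)) refl (seq x m) (seq x n))))
    (h m n le le′)

_-_ : ℝ → ℝ → ℝ
x - y = x + (- y)

module Boundedness where
  bounded : ∀ x → ∃₂ λ B N → 0ℚ ℚ.≤ B × (∀ n → N ℕ.≤ n → ℚ.∣ seq x n ∣ ℚ.≤ B)
  bounded x with cauchy x 1ℚ (ℚ.positive⁻¹ 1ℚ)
  ... | N , h = 1ℚ ℚ.+ ℚ.∣ seq x N ∣ , N ,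
    0≤+ (ℚ.nonNegative⁻¹ 1ℚ) (ℚ.0≤∣p∣ (seq x N)) , λ n N≤n →
    begin
    ℚ.∣ seq x n ∣
      ≡⟨ cong ℚ.∣_∣ (solve 2 (λ a b → a := (a :- b) :+ b) refl (seq x n) (seq x N)) ⟩
    ℚ.∣ (seq x n ℚ.- seq x N) ℚ.+ seq x N ∣
      ≤⟨ ℚ.∣p+q∣≤∣p∣+∣q∣ (seq x n ℚ.- seq x N) (seq x N) ⟩
    ℚ.∣ seq x n ℚ.- seq x N ∣ ℚ.+ ℚ.∣ seq x N ∣
      ≤⟨ ℚ.+-monoˡ-≤ ℚ.∣ seq x N ∣ (ℚ.<⇒≤ (h n N N≤n ℕ.≤-refl)) ⟩
    1ℚ ℚ.+ ℚ.∣ seq x N ∣ ∎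

open Boundedness

_*_ : ℝ → ℝ → ℝ
seq    (x * y) n = seq x n ℚ.* seq y n
cauchy (x * y) ε 0<ε =
  let A , I , 0≤A , ∣x∣≤A = bounded x
      B , J , 0≤B , ∣y∣≤B = bounded y
      K , small = scale (A ℚ.+ B) (half ε) (0<half 0<ε)
      δ = unit K
      M , hx = cauchy x δ (0<unit K)
      N , hy = cauchy y δ (0<unit K)
      P = (I ℕ.⊔ J) ℕ.⊔ (M ℕ.⊔ N)
      P≥I : I ℕ.≤ P
      P≥I = ℕ.≤-trans (ℕ.m≤m⊔n I J) (ℕ.m≤m⊔n (I ℕ.⊔ J) (M ℕ.⊔ N))
      P≥J : J ℕ.≤ P
      P≥J = ℕ.≤-trans (ℕ.m≤n⊔m I J) (ℕ.m≤m⊔n (I ℕ.⊔ J) (M ℕ.⊔ N))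
      P≥M : M ℕ.≤ P
      P≥M = ℕ.≤-trans (ℕ.m≤m⊔n M N) (ℕ.m≤n⊔m (I ℕ.⊔ J) (M ℕ.⊔ N))
      P≥N : N ℕ.≤ P
      P≥N = ℕ.≤-trans (ℕ.m≤n⊔m M N) (ℕ.m≤n⊔m (I ℕ.⊔ J) (M ℕ.⊔ N))
  in P , λ m n le le′ →
    let a = seq x m ; b = seq y m ; c = seq x n ; d = seq y n
    in begin-strict
    ℚ.∣ a ℚ.* b ℚ.- c ℚ.* d ∣
      ≡⟨ cong ℚ.∣_∣ (solve 4 (λ a b c d → a :* b :- c :* d := a :* (b :- d) :+ d :* (a :- c)) refl a b c d) ⟩
    ℚ.∣ a ℚ.* (b ℚ.- d) ℚ.+ d ℚ.* (a ℚ.- c) ∣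
      ≤⟨ ℚ.∣p+q∣≤∣p∣+∣q∣ (a ℚ.* (b ℚ.- d)) (d ℚ.* (a ℚ.- c)) ⟩
    ℚ.∣ a ℚ.* (b ℚ.- d) ∣ ℚ.+ ℚ.∣ d ℚ.* (a ℚ.- c) ∣
      ≡⟨ cong₂ ℚ._+_ (ℚ.∣p*q∣≡∣p∣*∣q∣ a (b ℚ.- d)) (ℚ.∣p*q∣≡∣p∣*∣q∣ d (a ℚ.- c)) ⟩
    ℚ.∣ a ∣ ℚ.* ℚ.∣ b ℚ.- d ∣ ℚ.+ ℚ.∣ d ∣ ℚ.* ℚ.∣ a ℚ.- c ∣
      ≤⟨ ℚ.+-mono-≤
           (*-mono (ℚ.0≤∣p∣ a) (ℚ.<⇒≤ (0<unit K)) (∣x∣≤A m (ℕ.≤-trans P≥I le))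
                   (ℚ.<⇒≤ (hy m n (ℕ.≤-trans P≥N le) (ℕ.≤-trans P≥N le′))))
           (*-mono (ℚ.0≤∣p∣ d) (ℚ.<⇒≤ (0<unit K)) (∣y∣≤B n (ℕ.≤-trans P≥J le′))
                   (ℚ.<⇒≤ (hx m n (ℕ.≤-trans P≥M le) (ℕ.≤-trans P≥M le′)))) ⟩
    A ℚ.* δ ℚ.+ B ℚ.* δ ≡⟨ ℚ.*-distribʳ-+ δ A B ⟨
    (A ℚ.+ B) ℚ.* δ ≤⟨ small K ℕ.≤-refl ⟩
    half ε ≡⟨ ℚ.+-identityʳ (half ε) ⟨
    half ε ℚ.+ 0ℚ <⟨ ℚ.+-monoʳ-< (half ε) (0<half 0<ε) ⟩
    half ε ℚ.+ half ε ≡⟨ half+half ε ⟩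
    ε ∎

-- xᵏ / k!
expTerm : ℝ → ℕ → ℝ
expTerm x zero    = 1ℝ
expTerm x (suc k) = expTerm x k * (x * fromℚ (+ 1 ℚ./ suc k))

-- The sum of xᵏ / k! over 0 ≤ k ≤ n
expSum : ℝ → ℕ → ℝ
expSum x zero    = expTerm x zero
expSum x (suc n) = expSum x n + expTerm x (suc n)

module ExpTail where
  t S : ℚ → ℕ → ℚ
  t B zero    = 1ℚ
  t B (suc k) = t B k ℚ.* (B ℚ.* unit k)
  S B zero    = t B zero
  S B (suc n) = S B n ℚ.+ t B (suc n)

  module Tail (B : ℚ) (0≤B : 0ℚ ℚ.≤ B) where

    0≤Bu : ∀ k → 0ℚ ℚ.≤ B ℚ.* unit k
    0≤Bu k = 0≤* 0≤B (ℚ.<⇒≤ (0<unit k))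

    0≤t : ∀ k → 0ℚ ℚ.≤ t B k
    0≤t zero    = ℚ.nonNegative⁻¹ 1ℚ
    0≤t (suc k) = 0≤* (0≤t k) (0≤Bu k)

    S+≤ : ∀ k → B ℚ.* unit k ℚ.≤ ½ → S B (suc k) ℚ.+ t B (suc k) ℚ.≤ S B k ℚ.+ t B k
    S+≤ k Bu≤½ = begin
      (S B k ℚ.+ t B (suc k)) ℚ.+ t B (suc k)
        ≡⟨ ℚ.+-assoc (S B k) (t B (suc k)) (t B (suc k)) ⟩
      S B k ℚ.+ (t B (suc k) ℚ.+ t B (suc k))
        ≤⟨ ℚ.+-monoʳ-≤ (S B k) (ℚ.+-mono-≤ (*-monoˡ (0≤t k) Bu≤½) (*-monoˡ (0≤t k) Bu≤½)) ⟩
      S B k ℚ.+ (t B k ℚ.* ½ ℚ.+ t B k ℚ.* ½)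
        ≡⟨ cong (S B k ℚ.+_) (solve 1 (λ e → e :* con ½ :+ e :* con ½ := e) refl (t B k)) ⟩
      S B k ℚ.+ t B k ∎

    K : ℕ
    K = proj₁ (scale B ½ (ℚ.positive⁻¹ ½))

    S+-antitone : ∀ {k m} → K ℕ.≤ k → k ℕ.≤′ m → S B m ℚ.+ t B m ℚ.≤ S B k ℚ.+ t B k
    S+-antitone K≤k (ℕ.≤′-reflexive refl) = ℚ.≤-refl
    S+-antitone {k} {suc m} K≤k (ℕ.≤′-step k≤m) = ℚ.≤-trans
      (S+≤ m (proj₂ (scale B ½ (ℚ.positive⁻¹ ½)) m (ℕ.≤-trans K≤k (ℕ.≤′⇒≤ k≤m))))
      (S+-antitone K≤k k≤m)

    0≤S : ∀ k → 0ℚ ℚ.≤ S B k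
    0≤S zero    = 0≤t zero
    0≤S (suc k) = 0≤+ (0≤S k) (0≤t (suc k))

    tail≤t : ∀ {k m} → K ℕ.≤ k → k ℕ.≤ m → S B m ℚ.- S B k ℚ.≤ t B k
    tail≤t {k} {m} K≤k k≤m = begin
      S B m ℚ.- S B k           ≡⟨ cong (ℚ._- S B k) (ℚ.+-identityʳ (S B m)) ⟨
      S B m ℚ.+ 0ℚ ℚ.- S B k
        ≤⟨ ℚ.+-monoˡ-≤ (ℚ.- S B k) (ℚ.≤-trans (ℚ.+-monoʳ-≤ (S B m) (0≤t m)) (S+-antitone K≤k (ℕ.≤⇒≤′ k≤m))) ⟩
      S B k ℚ.+ t B k ℚ.- S B k ≡⟨ solve 2 (λ a b → a :+ b :- a := b) refl (S B k) (t B k) ⟩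
      t B k ∎

    t≤C : ∀ {k} → K ℕ.≤ k → t B k ℚ.≤ S B K ℚ.+ t B K
    t≤C {k} K≤k = ℚ.≤-trans
      (subst (ℚ._≤ S B k ℚ.+ t B k) (ℚ.+-identityˡ (t B k)) (ℚ.+-monoˡ-≤ (t B k) (0≤S k)))
      (S+-antitone ℕ.≤-refl (ℕ.≤⇒≤′ K≤k))

    tail : ∀ ε → 0ℚ ℚ.< ε → ∃ λ M → ∀ m → M ℕ.≤ m → S B m ℚ.- S B M ℚ.≤ ε
    tail ε 0<ε = let C = S B K ℚ.+ t B K
                     L , small = scale (C ℚ.* B) ε 0<ε
                     k = K ℕ.⊔ L
      in suc k , λ m M≤m → begin
      S B m ℚ.- S B (suc k)    ≤⟨ tail≤t (ℕ.≤-trans (ℕ.m≤m⊔n K L) (ℕ.n≤1+n k)) M≤m ⟩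
      t B k ℚ.* (B ℚ.* unit k) ≤⟨ *-monoʳ (0≤Bu k) (t≤C (ℕ.m≤m⊔n K L)) ⟩
      C ℚ.* (B ℚ.* unit k)     ≡⟨ ℚ.*-assoc C B (unit k) ⟨
      (C ℚ.* B) ℚ.* unit k     ≤⟨ small k (ℕ.m≤n⊔m K L) ⟩
      ε ∎

    module _ (x : ℝ) (n : ℕ) (∣x∣≤B : ℚ.∣ seq x n ∣ ℚ.≤ B) where

      ∣term∣≤t : ∀ k → ℚ.∣ seq (expTerm x k) n ∣ ℚ.≤ t B k
      ∣term∣≤t zero    = ℚ.≤-refl
      ∣term∣≤t (suc k) = let p = seq (expTerm x k) n ; a = seq x n in begin
        ℚ.∣ p ℚ.* (a ℚ.* unit k) ∣
          ≡⟨ trans (ℚ.∣p*q∣≡∣p∣*∣q∣ p (a ℚ.* unit k)) (cong (ℚ.∣ p ∣ ℚ.*_)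
               (trans (ℚ.∣p*q∣≡∣p∣*∣q∣ a (unit k))
                      (cong (ℚ.∣ a ∣ ℚ.*_) (ℚ.0≤p⇒∣p∣≡p (ℚ.<⇒≤ (0<unit k)))))) ⟩
        ℚ.∣ p ∣ ℚ.* (ℚ.∣ a ∣ ℚ.* unit k)
          ≤⟨ *-mono (ℚ.0≤∣p∣ p) (0≤Bu k) (∣term∣≤t k) (*-monoʳ (ℚ.<⇒≤ (0<unit k)) ∣x∣≤B) ⟩
        t B k ℚ.* (B ℚ.* unit k) ∎

      ∣sum∣≤ : ∀ {k m} → k ℕ.≤′ m →
        ℚ.∣ seq (expSum x m) n ℚ.- seq (expSum x k) n ∣ ℚ.≤ S B m ℚ.- S B k
      ∣sum∣≤ {k} (ℕ.≤′-reflexive refl) = ℚ.≤-reflexive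
        (trans (cong ℚ.∣_∣ (ℚ.+-inverseʳ (seq (expSum x k) n))) (sym (ℚ.+-inverseʳ (S B k))))
      ∣sum∣≤ {k} {suc m} (ℕ.≤′-step k≤m) =
        let p = seq (expSum x m) n ; q = seq (expTerm x (suc m)) n ; r = seq (expSum x k) n
            swap = solve 3 (λ p q r → p :+ q :- r := (p :- r) :+ q) refl
        in begin
        ℚ.∣ p ℚ.+ q ℚ.- r ∣             ≡⟨ cong ℚ.∣_∣ (swap p q r) ⟩
        ℚ.∣ (p ℚ.- r) ℚ.+ q ∣           ≤⟨ ℚ.∣p+q∣≤∣p∣+∣q∣ (p ℚ.- r) q ⟩
        ℚ.∣ p ℚ.- r ∣ ℚ.+ ℚ.∣ q ∣       ≤⟨ ℚ.+-mono-≤ (∣sum∣≤ k≤m) (∣term∣≤t (suc m)) ⟩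
        S B m ℚ.- S B k ℚ.+ t B (suc m) ≡⟨ swap (S B m) (t B (suc m)) (S B k) ⟨
        S B (suc m) ℚ.- S B k ∎

open ExpTail

-- The limit of expSum x n as n → ∞.  The partial sums converge uniformly on
-- bounded sets, so the diagonal sequence of rational approximations
-- represents it.
exp : ℝ → ℝ
seq    (exp x) n = seq (expSum x n) n
cauchy (exp x) ε 0<ε =
  let η  = half ε
      θ  = half η
      B , I , 0≤B , ∣x∣≤B = bounded x
      M , small = Tail.tail B 0≤B θ (0<half (0<half 0<ε))
      N , close = cauchy (expSum x M) η (0<half 0<ε)
      P = (I ℕ.⊔ M) ℕ.⊔ N
      P≥I : I ℕ.≤ P
      P≥I = ℕ.≤-trans (ℕ.m≤m⊔n I M) (ℕ.m≤m⊔n (I ℕ.⊔ M) N)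
      P≥M : M ℕ.≤ P
      P≥M = ℕ.≤-trans (ℕ.m≤n⊔m I M) (ℕ.m≤m⊔n (I ℕ.⊔ M) N)
      P≥N : N ℕ.≤ P
      P≥N = ℕ.m≤n⊔m (I ℕ.⊔ M) N
      near : ∀ m → P ℕ.≤ m → ℚ.∣ seq (expSum x m) m ℚ.- seq (expSum x M) m ∣ ℚ.≤ θ
      near m le = ℚ.≤-trans
        (Tail.∣sum∣≤ B 0≤B x m (∣x∣≤B m (ℕ.≤-trans P≥I le)) (ℕ.≤⇒≤′ (ℕ.≤-trans P≥M le)))
        (small m (ℕ.≤-trans P≥M le))
  in P , λ m n le le′ →
    let a = seq (expSum x m) m ; b = seq (expSum x M) m
        c = seq (expSum x M) n ; d = seq (expSum x n) n
    in begin-strict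
    ℚ.∣ a ℚ.- d ∣                                      ≤⟨ ∣p-r∣≤ a b d ⟩
    ℚ.∣ a ℚ.- b ∣ ℚ.+ ℚ.∣ b ℚ.- d ∣
      ≤⟨ ℚ.+-mono-≤ (near m le) (∣p-r∣≤ b c d) ⟩
    θ ℚ.+ (ℚ.∣ b ℚ.- c ∣ ℚ.+ ℚ.∣ c ℚ.- d ∣)
      ≤⟨ ℚ.+-monoʳ-≤ θ (ℚ.+-monoʳ-≤ ℚ.∣ b ℚ.- c ∣
           (subst (ℚ._≤ θ) (∣p-q∣-sym d c) (near n le′))) ⟩
    θ ℚ.+ (ℚ.∣ b ℚ.- c ∣ ℚ.+ θ)
      <⟨ ℚ.+-monoʳ-< θ (ℚ.+-monoˡ-< θ (close m n (ℕ.≤-trans P≥N le) (ℕ.≤-trans P≥N le′))) ⟩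
    θ ℚ.+ (η ℚ.+ θ)
      ≡⟨ solve 1 (λ e → con ½ :* (con ½ :* e) :+ (con ½ :* e :+ con ½ :* (con ½ :* e)) := e) refl ε ⟩
    ε ∎

ArithFun : Set
ArithFun = (m : ℕ) .{{_ : NonZero m}} → ℝ

Additive : ArithFun → Set
Additive f = ∀ x y .{{_ : NonZero x}} .{{_ : NonZero y}} → Coprime x y →
  f (x ℕ.* y) {{ℕ.m*n≢0 x y}} ≈ f x + f y

record Multiplicative (g : ArithFun) : Set where
  field
    not-zero : ¬ (∀ x .{{_ : NonZero x}} → g x ≈ 0ℝ)
    mult     : ∀ x y .{{_ : NonZero x}} .{{_ : NonZero y}} → Coprime x y →
               g (x ℕ.* y) {{ℕ.m*n≢0 x y}} ≈ g x * g y

record 𝒜 (f : ArithFun) : Set where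
  field
    additive : Additive f
    nonneg   : ∀ x .{{_ : NonZero x}} → x ℕ.> 1 → 0ℝ ≤ f x

record ℳ (g : ArithFun) : Set where
  field
    multiplicative : Multiplicative g
    ≥1             : ∀ x .{{_ : NonZero x}} → x ℕ.> 1 → 1ℝ ≤ g x

record ℐ (h : ArithFun) : Set where
  field
    multiplicative : Multiplicative h
    ≥0             : ∀ x .{{_ : NonZero x}} → x ℕ.> 1 → 0ℝ ≤ h x
    ≤1             : ∀ x .{{_ : NonZero x}} → x ℕ.> 1 → h x ≤ 1ℝ

record ℐ₀ (h : ArithFun) : Set where
  field
    inℐ : ℐ h
    >0  : ∀ x .{{_ : NonZero x}} → x ℕ.> 1 → 0ℝ < h x

atGcd : ArithFun → (n : ℕ) .{{_ : NonZero n}} → ℤ → ℝ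
atGcd k n x = k (gcd ∣ x ∣ n) {{ℕ.≢-nonZero (gcd[m,n]≢0 ∣ x ∣ n (inj₂ (ℕ.≢-nonZero⁻¹ n)))}}

offDiagonal : (ℤ → ℤ → ℝ) → ℤ → ℤ → ℝ
offDiagonal d x y with x ℤ.≟ y
... | yes _ = 0ℝ
... | no  _ = d x y

-- The suffixes 𝒜+, ℳ+, ℐ+, ℐ· name the class the function is taken from
-- and the operation combining its values.
d𝒜+ dℳ+ dℐ+ dℐ· : (n : ℕ) .{{_ : NonZero n}} → ArithFun → ℤ → ℤ → ℝ
d𝒜+ n f = offDiagonal λ x y → atGcd f n x + atGcd f n y
dℳ+ n g = offDiagonal λ x y → atGcd g n x + atGcd g n y - 2ℝ
dℐ+ n h = offDiagonal λ x y → 2ℝ - atGcd h n x - atGcd h n y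
dℐ· n h = offDiagonal λ x y → 1ℝ - atGcd h n x * atGcd h n y

infix 4 _⪯[_]_
_⪯[_]_ : ℤ → (ℤ → ℤ → ℝ) → ℤ → Set
x ⪯[ d ] y = d (+ 1) x ≤ d (+ 1) y

{-# OPTIONS --safe #-}

-- Since f 1 ≈ 0 and g 1 ≈ h 1 ≈ 1, the distances from 1 are, with v = gcd (x , n),
-- f v, g v - 1, 1 - h v and again 1 - h v, also on the diagonal.  As exp is strictly
-- increasing, all four preorders are x ⪯ y ⇔ f (gcd (x , n)) ≤ f (gcd (y , n)).
-- The functional equation of exp is a Cauchy product: the square i, j ≤ n of
-- products of terms of the two series differs from the triangle i + j ≤ n by at
-- most a tail of the series for ∣ x ∣ + ∣ y ∣.

module Submission where

open import Defs
open import Data.Nat.Base using (ℕ; NonZero; _>_)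
open import Data.Integer.Base using (ℤ)
open import Data.Product.Base using (_×_)
open import Function.Bundles using (_⇔_)
open import Relation.Nullary using (¬_)

open import Data.Nat.Base as ℕ using (zero; suc)
import Data.Nat.Properties as ℕ
open import Data.Nat.Coprimality using (1-coprimeTo)
open import Data.Nat.GCD using (gcd[m,n]≢0; gcd-zeroˡ)
open import Data.Integer.Base as ℤ using (+_)
import Data.Integer.Properties as ℤ
open import Data.Rational.Base as ℚ using (ℚ; 0ℚ; 1ℚ; ½)
import Data.Rational.Properties as ℚ
open import Data.Rational.Solver using (module +-*-Solver)
import Data.Rational.Unnormalised.Base as ℚᵘ
import Data.Rational.Unnormalised.Properties as ℚᵘ
open import Data.Product.Base using (∃; _,_; proj₁; proj₂)
open import Data.Sum.Base using (_⊎_; inj₁; inj₂)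
open import Function.Base using (_∘_)
open import Function.Bundles using (mk⇔)
import Function.Properties.Equivalence as ⇔
open import Level using (0ℓ)
open import Relation.Binary.Bundles using (Poset)
open import Relation.Binary.PropositionalEquality
  using (_≡_; refl; sym; trans; cong; cong₂; subst; module ≡-Reasoning)
open import Relation.Nullary using (Dec; yes; no)
open import Relation.Nullary.Negation using (contradiction)

open +-*-Solver using (solve; con; _:+_; _:*_; _:-_; :-_; _:=_)
open ℚFacts
open ExpTail
open Boundedness

-- Formal power series over ℚ

-- Term `n` of `exp x` is the partial sum `S (seq x n) n`, so the functional equation is a rational
-- inequality at each index, with an error uniform over bounded arguments. Signs do not reduce to
-- single terms in this way: `x ≤ y` tolerates any positive error in late terms, so a sequence for a
-- nonnegative real may have negative terms, and neither order nor equality can be decided.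
-- Monotonicity is therefore drawn from the algebra: `exp x` is the square of `exp (x / 2)`,
-- inequalities can be multiplied by squares, and `exp y` is `exp x` times `exp (y - x)`, whose
-- second factor is at least 1 if `x ≤ y`. For the same reason the value of a multiplicative
-- function at 1 takes an argument by apartness and not by cases on `x ≈ 0ℝ`.

Series : Set
Series = ℕ → ℚ

∑ : Series → Series
∑ u zero    = u zero
∑ u (suc n) = ∑ u n ℚ.+ u (suc n)

infixl 7 _⊛_
-- The Cauchy product. Splitting off `u 0` leaves a product with the shifted series, so proofs are
-- inductions over the index for all first factors, without sums over index pairs.
_⊛_ : Series → Series → Series
(u ⊛ v) zero    = u 0 ℚ.* v 0
(u ⊛ v) (suc n) = u 0 ℚ.* v (suc n) ℚ.+ (u ∘ suc ⊛ v) n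

-- The formal derivative; it serves to prove the binomial theorem without binomial coefficients.
∂ : Series → Series
∂ u n = nat (suc n) ℚ.* u (suc n)

nat-suc : ∀ n → nat (suc n) ≡ 1ℚ ℚ.+ nat n
nat-suc n = ℚ.toℚᵘ-injective
  (ℚᵘ.≃-trans (ℚ.toℚᵘ-fromℚᵘ (ℚᵘ.mkℚᵘ (+ suc n) 0))
    (ℚᵘ.≃-trans (ℚᵘ.*≡* lemma)
      (ℚᵘ.≃-sym (ℚᵘ.≃-trans (ℚ.toℚᵘ-homo-+ 1ℚ (nat n))
        (ℚᵘ.+-congʳ ℚᵘ.1ℚᵘ (ℚ.toℚᵘ-fromℚᵘ (ℚᵘ.mkℚᵘ (+ n) 0)))))))
  where
  lemma : (+ suc n) ℤ.* (+ 1) ≡ ((+ 1) ℤ.* (+ 1) ℤ.+ (+ n) ℤ.* (+ 1)) ℤ.* (+ 1)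
  lemma = cong (ℤ._* (+ 1)) (cong (ℤ._+_ (+ 1)) (sym (ℤ.*-identityʳ (+ n))))

nat*unit : ∀ n → nat (suc n) ℚ.* unit n ≡ 1ℚ
nat*unit n = ℚ.toℚᵘ-injective
  (ℚᵘ.≃-trans (ℚ.toℚᵘ-homo-* (nat (suc n)) (unit n))
    (ℚᵘ.≃-trans (ℚᵘ.*-cong (ℚ.toℚᵘ-fromℚᵘ (ℚᵘ.mkℚᵘ (+ suc n) 0)) (ℚ.toℚᵘ-fromℚᵘ (ℚᵘ.mkℚᵘ (+ 1) n)))
      (ℚᵘ.*-inverseʳ (ℚᵘ.mkℚᵘ (+ suc n) 0))))

⊛-cong : ∀ {u u′ v v′} → (∀ n → u n ≡ u′ n) → (∀ n → v n ≡ v′ n) → ∀ n → (u ⊛ v) n ≡ (u′ ⊛ v′) n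
⊛-cong p q zero    = cong₂ ℚ._*_ (p 0) (q 0)
⊛-cong p q (suc n) = cong₂ ℚ._+_ (cong₂ ℚ._*_ (p 0) (q (suc n))) (⊛-cong (p ∘ suc) q n)

⊛-distribʳ : ∀ u w v n → ((λ k → u k ℚ.+ w k) ⊛ v) n ≡ (u ⊛ v) n ℚ.+ (w ⊛ v) n
⊛-distribʳ u w v zero    = ℚ.*-distribʳ-+ (v 0) (u 0) (w 0)
⊛-distribʳ u w v (suc n) = trans (cong ((u 0 ℚ.+ w 0) ℚ.* v (suc n) ℚ.+_) (⊛-distribʳ (u ∘ suc) (w ∘ suc) v n))
  (solve 5 (λ a b c d e → (a :+ b) :* c :+ (d :+ e) := (a :* c :+ d) :+ (b :* c :+ e)) refl
    (u 0) (w 0) (v (suc n)) ((u ∘ suc ⊛ v) n) ((w ∘ suc ⊛ v) n))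

⊛-scaleˡ : ∀ c u v n → ((λ k → c ℚ.* u k) ⊛ v) n ≡ c ℚ.* (u ⊛ v) n
⊛-scaleˡ c u v zero    = ℚ.*-assoc c (u 0) (v 0)
⊛-scaleˡ c u v (suc n) = trans (cong (c ℚ.* u 0 ℚ.* v (suc n) ℚ.+_) (⊛-scaleˡ c (u ∘ suc) v n))
  (solve 4 (λ c a b d → c :* a :* b :+ c :* d := c :* (a :* b :+ d)) refl
    c (u 0) (v (suc n)) ((u ∘ suc ⊛ v) n))

⊛-scaleʳ : ∀ c u v n → (u ⊛ (λ k → c ℚ.* v k)) n ≡ c ℚ.* (u ⊛ v) n
⊛-scaleʳ c u v zero    = solve 3 (λ c a b → a :* (c :* b) := c :* (a :* b)) refl c (u 0) (v 0)
⊛-scaleʳ c u v (suc n) = trans (cong (u 0 ℚ.* (c ℚ.* v (suc n)) ℚ.+_) (⊛-scaleʳ c (u ∘ suc) v n))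
  (solve 4 (λ c a b d → a :* (c :* b) :+ c :* d := c :* (a :* b :+ d)) refl
    c (u 0) (v (suc n)) ((u ∘ suc ⊛ v) n))

-- The shift of a derivative is not the derivative of the shift: it has an
-- extra summand, which supplies the missing unit of the factor n + 1.
∂-suc : ∀ u n → ∂ u (suc n) ≡ u (suc (suc n)) ℚ.+ ∂ (u ∘ suc) n
∂-suc u n = trans (cong (ℚ._* u (suc (suc n))) (nat-suc (suc n)))
  (solve 2 (λ m a → (con 1ℚ :+ m) :* a := a :+ m :* a) refl (nat (suc n)) (u (suc (suc n))))

-- The factor n + 2 splits as 1 + (n + 1). Multiplied by n + 1, the product `X` falls under the
-- induction hypothesis for `u ∘ suc`; the single `X` left over supplies the head
-- `∂ u 0 * v (suc n)` and the extra summands of `∂-suc`.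
leibniz : ∀ u v n → ∂ (u ⊛ v) n ≡ (∂ u ⊛ v) n ℚ.+ (u ⊛ ∂ v) n
leibniz u v zero = solve 4 (λ a b c d → con 1ℚ :* (a :* b :+ c :* d) := con 1ℚ :* c :* d :+ a :* (con 1ℚ :* b))
  refl (u 0) (v 1) (u 1) (v 0)
leibniz u v (suc n) = trans
  (cong (ℚ._* (u 0 ℚ.* v (suc (suc n)) ℚ.+ X)) (nat-suc (suc n)))
  (trans (solve 4 (λ m a b x → (con 1ℚ :+ m) :* (a :* b :+ x) := (x :+ m :* x) :+ a :* ((con 1ℚ :+ m) :* b))
            refl (nat (suc n)) (u 0) (v (suc (suc n))) X)
  (trans (cong₂ (λ p q → (X ℚ.+ p) ℚ.+ u 0 ℚ.* (q ℚ.* v (suc (suc n))))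
            (leibniz (u ∘ suc) v n) (sym (nat-suc (suc n))))
  (trans (solve 6 (λ a b c p q r → (a :* b :+ c :+ (p :+ q)) :+ r := (con 1ℚ :* a :* b :+ (c :+ p)) :+ (r :+ q)) refl
            (u 1) (v (suc n)) ((u ∘ suc ∘ suc ⊛ v) n) ((∂ (u ∘ suc) ⊛ v) n) ((u ∘ suc ⊛ ∂ v) n)
            (u 0 ℚ.* ∂ v (suc n)))
  (cong (λ p → (1ℚ ℚ.* u 1 ℚ.* v (suc n) ℚ.+ p) ℚ.+ (u ⊛ ∂ v) (suc n))
    (sym (trans (⊛-cong {v = v} (∂-suc u) (λ _ → refl) n)
                (⊛-distribʳ (u ∘ suc ∘ suc) (∂ (u ∘ suc)) v n)))))))
  where
  X = (u ∘ suc ⊛ v) (suc n)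

∂-t : ∀ a n → ∂ (t a) n ≡ a ℚ.* t a n
∂-t a n = trans (solve 4 (λ m p a k → m :* (p :* (a :* k)) := m :* k :* (a :* p)) refl
                   (nat (suc n)) (t a n) a (unit n))
  (trans (cong (ℚ._* (a ℚ.* t a n)) (nat*unit n)) (ℚ.*-identityˡ _))

-- Dividing by n + 1 turns the differential equation into the recursion that defines `t a`.
t-unique : ∀ a u → u 0 ≡ 1ℚ → (∀ n → ∂ u n ≡ a ℚ.* u n) → ∀ n → u n ≡ t a n
t-unique a u u₀ ∂u zero    = u₀
t-unique a u u₀ ∂u (suc n) = begin
  u (suc n)                                ≡⟨ ℚ.*-identityˡ (u (suc n)) ⟨
  1ℚ ℚ.* u (suc n)                         ≡⟨ cong (ℚ._* u (suc n)) (nat*unit n) ⟨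
  nat (suc n) ℚ.* unit n ℚ.* u (suc n)
    ≡⟨ solve 3 (λ m k p → m :* k :* p := m :* p :* k) refl (nat (suc n)) (unit n) (u (suc n)) ⟩
  ∂ u n ℚ.* unit n                         ≡⟨ cong (ℚ._* unit n) (∂u n) ⟩
  a ℚ.* u n ℚ.* unit n                     ≡⟨ cong (λ p → a ℚ.* p ℚ.* unit n) (t-unique a u u₀ ∂u n) ⟩
  a ℚ.* t a n ℚ.* unit n
    ≡⟨ solve 3 (λ a p k → a :* p :* k := p :* (a :* k)) refl a (t a n) (unit n) ⟩
  t a (suc n) ∎
  where open ≡-Reasoning

-- The binomial theorem: both sides solve ∂ u = (a + b) u with u 0 = 1.
t-⊛ : ∀ a b n → (t a ⊛ t b) n ≡ t (a ℚ.+ b) n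
t-⊛ a b = t-unique (a ℚ.+ b) (t a ⊛ t b) refl λ n → begin
  ∂ (t a ⊛ t b) n                                       ≡⟨ leibniz (t a) (t b) n ⟩
  (∂ (t a) ⊛ t b) n ℚ.+ (t a ⊛ ∂ (t b)) n
    ≡⟨ cong₂ ℚ._+_ (⊛-cong {v = t b} (∂-t a) (λ _ → refl) n) (⊛-cong {u = t a} (λ _ → refl) (∂-t b) n) ⟩
  ((λ k → a ℚ.* t a k) ⊛ t b) n ℚ.+ (t a ⊛ (λ k → b ℚ.* t b k)) n
    ≡⟨ cong₂ ℚ._+_ (⊛-scaleˡ a (t a) (t b) n) (⊛-scaleʳ b (t a) (t b) n) ⟩
  a ℚ.* (t a ⊛ t b) n ℚ.+ b ℚ.* (t a ⊛ t b) n           ≡⟨ ℚ.*-distribʳ-+ ((t a ⊛ t b) n) a b ⟨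
  (a ℚ.+ b) ℚ.* (t a ⊛ t b) n ∎
  where open ≡-Reasoning

S≡∑t : ∀ a n → S a n ≡ ∑ (t a) n
S≡∑t a zero    = refl
S≡∑t a (suc n) = cong (ℚ._+ t a (suc n)) (S≡∑t a n)

∑-cong : ∀ {u v} → (∀ n → u n ≡ v n) → ∀ n → ∑ u n ≡ ∑ v n
∑-cong p zero    = p 0
∑-cong p (suc n) = cong₂ ℚ._+_ (∑-cong p n) (p (suc n))

∑-head : ∀ u n → ∑ u (suc n) ≡ u 0 ℚ.+ ∑ (u ∘ suc) n
∑-head u zero    = refl
∑-head u (suc n) = trans (cong (ℚ._+ u (suc (suc n))) (∑-head u n)) (ℚ.+-assoc (u 0) _ _)

⊛-∑-suc : ∀ u v n → (u ⊛ ∑ v) (suc n) ≡ (u ⊛ ∑ v) n ℚ.+ (u ⊛ v) (suc n)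
⊛-∑-suc u v zero = solve 4 (λ a b c d → a :* (b :+ c) :+ d :* b := a :* b :+ (a :* c :+ d :* b)) refl
  (u 0) (v 0) (v 1) (u 1)
⊛-∑-suc u v (suc n) = trans (cong (u 0 ℚ.* ∑ v (suc (suc n)) ℚ.+_) (⊛-∑-suc (u ∘ suc) v n))
  (solve 5 (λ a b c d e → a :* (b :+ c) :+ (d :+ e) := (a :* b :+ d) :+ (a :* c :+ e)) refl
    (u 0) (∑ v (suc n)) (v (suc (suc n))) ((u ∘ suc ⊛ ∑ v) n) ((u ∘ suc ⊛ v) (suc n)))

-- Partial summation is multiplication by the geometric series, so this is associativity of the
-- product. Read by index pairs, both sides are the sum over the triangle i + j ≤ n.
⊛-∑ : ∀ u v n → (u ⊛ ∑ v) n ≡ ∑ (u ⊛ v) n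
⊛-∑ u v zero    = refl
⊛-∑ u v (suc n) = trans (⊛-∑-suc u v n) (cong (ℚ._+ (u ⊛ v) (suc n)) (⊛-∑ u v n))

t⊛∑t : ∀ a b n → (t a ⊛ ∑ (t b)) n ≡ S (a ℚ.+ b) n
t⊛∑t a b n = trans (⊛-∑ (t a) (t b) n) (trans (∑-cong (t-⊛ a b) n) (sym (S≡∑t (a ℚ.+ b) n)))

-- Majorants of series

infix 4 _⊑_
_⊑_ : Series → Series → Set
u ⊑ v = ∀ k → ℚ.∣ u k ∣ ℚ.≤ v k

⊑⇒0≤ : ∀ {u v} → u ⊑ v → ∀ k → 0ℚ ℚ.≤ v k
⊑⇒0≤ {u} u⊑v k = ℚ.≤-trans (ℚ.0≤∣p∣ (u k)) (u⊑v k)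

∑-difference : ∀ {u v} → u ⊑ v → ∀ {k n} → k ℕ.≤′ n → ℚ.∣ ∑ u n ℚ.- ∑ u k ∣ ℚ.≤ ∑ v n ℚ.- ∑ v k
∑-difference {u} {v} u⊑v {k} (ℕ.≤′-reflexive refl) = ℚ.≤-reflexive
  (trans (cong ℚ.∣_∣ (ℚ.+-inverseʳ (∑ u k))) (sym (ℚ.+-inverseʳ (∑ v k))))
∑-difference {u} {v} u⊑v {k} {suc n} (ℕ.≤′-step k≤n) = begin
  ℚ.∣ ∑ u n ℚ.+ u (suc n) ℚ.- ∑ u k ∣         ≡⟨ cong ℚ.∣_∣ (swap (∑ u n) (u (suc n)) (∑ u k)) ⟩
  ℚ.∣ ∑ u n ℚ.- ∑ u k ℚ.+ u (suc n) ∣         ≤⟨ ℚ.∣p+q∣≤∣p∣+∣q∣ (∑ u n ℚ.- ∑ u k) (u (suc n)) ⟩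
  ℚ.∣ ∑ u n ℚ.- ∑ u k ∣ ℚ.+ ℚ.∣ u (suc n) ∣   ≤⟨ ℚ.+-mono-≤ (∑-difference u⊑v k≤n) (u⊑v (suc n)) ⟩
  ∑ v n ℚ.- ∑ v k ℚ.+ v (suc n)               ≡⟨ swap (∑ v n) (v (suc n)) (∑ v k) ⟨
  ∑ v (suc n) ℚ.- ∑ v k ∎
  where
  open ℚ.≤-Reasoning
  swap = solve 3 (λ p q r → p :+ q :- r := p :- r :+ q) refl

0≤⊛ : ∀ {u v} → (∀ k → 0ℚ ℚ.≤ u k) → (∀ k → 0ℚ ℚ.≤ v k) → ∀ n → 0ℚ ℚ.≤ (u ⊛ v) n
0≤⊛ 0≤u 0≤v zero    = 0≤* (0≤u 0) (0≤v 0)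
0≤⊛ 0≤u 0≤v (suc n) = 0≤+ (0≤* (0≤u 0) (0≤v (suc n))) (0≤⊛ (0≤u ∘ suc) 0≤v n)

-- Both sides add up products u i · v j over finite sets of pairs (i , j); the
-- square i, j ≤ n without the triangle i + j ≤ n carries the difference.
∑*∑-⊛∑ : ∀ {u u′ v v′} → u ⊑ u′ → v ⊑ v′ → ∀ {n N} → n ℕ.≤ N →
  ℚ.∣ ∑ u n ℚ.* ∑ v N ℚ.- (u ⊛ ∑ v) n ∣ ℚ.≤ ∑ u′ n ℚ.* ∑ v′ N ℚ.- (u′ ⊛ ∑ v′) n
∑*∑-⊛∑ {u} {u′} {v} {v′} u⊑u′ v⊑v′ {zero} {N} _ = begin
  ℚ.∣ u 0 ℚ.* ∑ v N ℚ.- u 0 ℚ.* v 0 ∣       ≡⟨ cong ℚ.∣_∣ (factor (u 0) (∑ v N) (v 0)) ⟩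
  ℚ.∣ u 0 ℚ.* (∑ v N ℚ.- v 0) ∣             ≡⟨ ℚ.∣p*q∣≡∣p∣*∣q∣ (u 0) (∑ v N ℚ.- v 0) ⟩
  ℚ.∣ u 0 ∣ ℚ.* ℚ.∣ ∑ v N ℚ.- v 0 ∣         ≤⟨ *-mono (ℚ.0≤∣p∣ (u 0)) (ℚ.≤-trans (ℚ.0≤∣p∣ (∑ v N ℚ.- v 0)) tail) (u⊑u′ 0) tail ⟩
  u′ 0 ℚ.* (∑ v′ N ℚ.- v′ 0)                ≡⟨ factor (u′ 0) (∑ v′ N) (v′ 0) ⟨
  u′ 0 ℚ.* ∑ v′ N ℚ.- u′ 0 ℚ.* v′ 0 ∎
  where
  open ℚ.≤-Reasoning
  factor = solve 3 (λ a b c → a :* b :- a :* c := a :* (b :- c)) refl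
  tail = ∑-difference v⊑v′ {0} {N} (ℕ.≤⇒≤′ ℕ.z≤n)
∑*∑-⊛∑ {u} {u′} {v} {v′} u⊑u′ v⊑v′ {suc n} {N} n<N = begin
  ℚ.∣ ∑ u (suc n) ℚ.* V ℚ.- (u ⊛ ∑ v) (suc n) ∣
    ≡⟨ cong ℚ.∣_∣ (split u v) ⟩
  ℚ.∣ u 0 ℚ.* d ℚ.+ r ∣
    ≤⟨ ℚ.∣p+q∣≤∣p∣+∣q∣ (u 0 ℚ.* d) r ⟩
  ℚ.∣ u 0 ℚ.* d ∣ ℚ.+ ℚ.∣ r ∣
    ≡⟨ cong (ℚ._+ ℚ.∣ r ∣) (ℚ.∣p*q∣≡∣p∣*∣q∣ (u 0) d) ⟩
  ℚ.∣ u 0 ∣ ℚ.* ℚ.∣ d ∣ ℚ.+ ℚ.∣ r ∣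
    ≤⟨ ℚ.+-mono-≤ (*-mono (ℚ.0≤∣p∣ (u 0)) (ℚ.≤-trans (ℚ.0≤∣p∣ d) tail) (u⊑u′ 0) tail)
         (∑*∑-⊛∑ (u⊑u′ ∘ suc) v⊑v′ (ℕ.<⇒≤ n<N)) ⟩
  u′ 0 ℚ.* (∑ v′ N ℚ.- ∑ v′ (suc n)) ℚ.+ (∑ (u′ ∘ suc) n ℚ.* ∑ v′ N ℚ.- (u′ ∘ suc ⊛ ∑ v′) n)
    ≡⟨ split u′ v′ ⟨
  ∑ u′ (suc n) ℚ.* ∑ v′ N ℚ.- (u′ ⊛ ∑ v′) (suc n) ∎
  where
  open ℚ.≤-Reasoning
  V = ∑ v N
  d = V ℚ.- ∑ v (suc n)
  r = ∑ (u ∘ suc) n ℚ.* V ℚ.- (u ∘ suc ⊛ ∑ v) n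
  tail = ∑-difference v⊑v′ (ℕ.≤⇒≤′ n<N)
  -- The row i = 0 contributes `u 0` times the tail of `v` past `suc n`; the other rows are the same
  -- difference for `u ∘ suc` and `n`. `N` stays fixed meanwhile, hence is a separate variable.
  split : ∀ u v → ∑ u (suc n) ℚ.* ∑ v N ℚ.- (u ⊛ ∑ v) (suc n) ≡
    u 0 ℚ.* (∑ v N ℚ.- ∑ v (suc n)) ℚ.+ (∑ (u ∘ suc) n ℚ.* ∑ v N ℚ.- (u ∘ suc ⊛ ∑ v) n)
  split u v = trans (cong (λ p → p ℚ.* ∑ v N ℚ.- (u ⊛ ∑ v) (suc n)) (∑-head u n))
    (solve 5 (λ a b c d e → (a :+ b) :* c :- (a :* d :+ e) := a :* (c :- d) :+ (b :* c :- e)) refl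
      (u 0) (∑ (u ∘ suc) n) (∑ v N) (∑ v (suc n)) ((u ∘ suc ⊛ ∑ v) n))

0≤∑ : ∀ {u} → (∀ k → 0ℚ ℚ.≤ u k) → ∀ n → 0ℚ ℚ.≤ ∑ u n
0≤∑ 0≤u zero    = 0≤u 0
0≤∑ 0≤u (suc n) = 0≤+ (0≤∑ 0≤u n) (0≤u (suc n))

-- For nonnegative terms: the rectangle i ≤ m, j ≤ n lies in the triangle i + j ≤ m + n.
∑*∑≤⊛∑ : ∀ {u v} → (∀ k → 0ℚ ℚ.≤ u k) → (∀ k → 0ℚ ℚ.≤ v k) →
  ∀ m n → ∑ u m ℚ.* ∑ v n ℚ.≤ (u ⊛ ∑ v) (m ℕ.+ n)
∑*∑≤⊛∑ {u} {v} 0≤u 0≤v zero zero    = ℚ.≤-refl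
∑*∑≤⊛∑ {u} {v} 0≤u 0≤v zero (suc n) = begin
  u 0 ℚ.* ∑ v (suc n)           ≡⟨ ℚ.+-identityʳ _ ⟨
  u 0 ℚ.* ∑ v (suc n) ℚ.+ 0ℚ    ≤⟨ ℚ.+-monoʳ-≤ (u 0 ℚ.* ∑ v (suc n)) (0≤⊛ (0≤u ∘ suc) (0≤∑ 0≤v) n) ⟩
  (u ⊛ ∑ v) (suc n) ∎
  where open ℚ.≤-Reasoning
∑*∑≤⊛∑ {u} {v} 0≤u 0≤v (suc m) n = begin
  ∑ u (suc m) ℚ.* ∑ v n                                     ≡⟨ cong (ℚ._* ∑ v n) (∑-head u m) ⟩
  (u 0 ℚ.+ ∑ (u ∘ suc) m) ℚ.* ∑ v n                         ≡⟨ ℚ.*-distribʳ-+ (∑ v n) (u 0) _ ⟩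
  u 0 ℚ.* ∑ v n ℚ.+ ∑ (u ∘ suc) m ℚ.* ∑ v n
    ≤⟨ ℚ.+-mono-≤ (*-monoˡ (0≤u 0) (∑-mono (ℕ.≤⇒≤′ (ℕ.≤-trans (ℕ.m≤n+m n m) (ℕ.n≤1+n (m ℕ.+ n))))))
                  (∑*∑≤⊛∑ (0≤u ∘ suc) 0≤v m n) ⟩
  (u ⊛ ∑ v) (suc m ℕ.+ n) ∎
  where
  open ℚ.≤-Reasoning
  ∑-mono : ∀ {k l} → k ℕ.≤′ l → ∑ v k ℚ.≤ ∑ v l
  ∑-mono (ℕ.≤′-reflexive refl) = ℚ.≤-refl
  ∑-mono {k} (ℕ.≤′-step {l} k≤l) = ℚ.≤-trans (∑-mono k≤l)
    (subst (ℚ._≤ ∑ v (suc l)) (ℚ.+-identityʳ (∑ v l)) (ℚ.+-monoʳ-≤ (∑ v l) (0≤v (suc l))))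

-- Partial sums of the exponential series

seq-expTerm : ∀ x k n → seq (expTerm x k) n ≡ t (seq x n) k
seq-expTerm x zero    n = refl
seq-expTerm x (suc k) n = cong (ℚ._* (seq x n ℚ.* unit k)) (seq-expTerm x k n)

seq-expSum : ∀ x k n → seq (expSum x k) n ≡ S (seq x n) k
seq-expSum x zero    n = refl
seq-expSum x (suc k) n = cong₂ ℚ._+_ (seq-expSum x k n) (seq-expTerm x (suc k) n)

seq-exp : ∀ x n → seq (exp x) n ≡ S (seq x n) n
seq-exp x n = seq-expSum x n n

t-⊑ : ∀ {a A} → ℚ.∣ a ∣ ℚ.≤ A → t a ⊑ t A
t-⊑ {a} {A} ∣a∣≤A k = subst (λ p → ℚ.∣ p ∣ ℚ.≤ t A k) (seq-expTerm (fromℚ a) k 0)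
  (Tail.∣term∣≤t A (ℚ.≤-trans (ℚ.0≤∣p∣ a) ∣a∣≤A) (fromℚ a) 0 ∣a∣≤A k)

-- The square of majorant terms lies between the triangles of sizes `n` and `n + n`, and both
-- triangle sums are partial sums of one series, that for `A + B`. The bound does not depend on `a`
-- and `b`.
S-homo-+ : ∀ {a A b B} → ℚ.∣ a ∣ ℚ.≤ A → ℚ.∣ b ∣ ℚ.≤ B → ∀ n →
  ℚ.∣ S a n ℚ.* S b n ℚ.- S (a ℚ.+ b) n ∣ ℚ.≤ S (A ℚ.+ B) (n ℕ.+ n) ℚ.- S (A ℚ.+ B) n
S-homo-+ {a} {A} {b} {B} ∣a∣≤A ∣b∣≤B n = begin
  ℚ.∣ S a n ℚ.* S b n ℚ.- S (a ℚ.+ b) n ∣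
    ≡⟨ cong ℚ.∣_∣ (cong₂ ℚ._-_ (cong₂ ℚ._*_ (S≡∑t a n) (S≡∑t b n)) (sym (t⊛∑t a b n))) ⟩
  ℚ.∣ ∑ (t a) n ℚ.* ∑ (t b) n ℚ.- (t a ⊛ ∑ (t b)) n ∣
    ≤⟨ ∑*∑-⊛∑ a⊑A b⊑B {n} ℕ.≤-refl ⟩
  ∑ (t A) n ℚ.* ∑ (t B) n ℚ.- (t A ⊛ ∑ (t B)) n
    ≤⟨ ℚ.+-monoˡ-≤ (ℚ.- (t A ⊛ ∑ (t B)) n) (∑*∑≤⊛∑ (⊑⇒0≤ a⊑A) (⊑⇒0≤ b⊑B) n n) ⟩
  (t A ⊛ ∑ (t B)) (n ℕ.+ n) ℚ.- (t A ⊛ ∑ (t B)) n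
    ≡⟨ cong₂ ℚ._-_ (t⊛∑t A B (n ℕ.+ n)) (t⊛∑t A B n) ⟩
  S (A ℚ.+ B) (n ℕ.+ n) ℚ.- S (A ℚ.+ B) n ∎
  where
  open ℚ.≤-Reasoning
  a⊑A = t-⊑ ∣a∣≤A
  b⊑B = t-⊑ ∣b∣≤B

S-monoʳ : ∀ {B} → 0ℚ ℚ.≤ B → ∀ {k n} → k ℕ.≤′ n → S B k ℚ.≤ S B n
S-monoʳ 0≤B (ℕ.≤′-reflexive refl) = ℚ.≤-refl
S-monoʳ {B} 0≤B {k} (ℕ.≤′-step {n} k≤n) = ℚ.≤-trans (S-monoʳ 0≤B k≤n)
  (subst (ℚ._≤ S B (suc n)) (ℚ.+-identityʳ (S B n)) (ℚ.+-monoʳ-≤ (S B n) (Tail.0≤t B 0≤B (suc n))))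

-- Linear inequalities over ℚ are proved by exhibiting the difference of the
-- two sides as a combination of quantities of known sign.

p≤q⇒0≤q-p : ∀ {p q} → p ℚ.≤ q → 0ℚ ℚ.≤ q ℚ.- p
p≤q⇒0≤q-p {p} {q} p≤q = subst (ℚ._≤ q ℚ.- p) (ℚ.+-inverseʳ p) (ℚ.+-monoˡ-≤ (ℚ.- p) p≤q)

p<q⇒0<q-p : ∀ {p q} → p ℚ.< q → 0ℚ ℚ.< q ℚ.- p
p<q⇒0<q-p {p} {q} p<q = subst (ℚ._< q ℚ.- p) (ℚ.+-inverseʳ p) (ℚ.+-monoˡ-< (ℚ.- p) p<q)

≤-by : ∀ {p q d} → 0ℚ ℚ.≤ d → p ℚ.+ d ≡ q → p ℚ.≤ q
≤-by {p} {q} {d} 0≤d refl = subst (ℚ._≤ p ℚ.+ d) (ℚ.+-identityʳ p) (ℚ.+-monoʳ-≤ p 0≤d)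

<-by : ∀ {p q d} → 0ℚ ℚ.< d → p ℚ.+ d ≡ q → p ℚ.< q
<-by {p} {q} {d} 0<d refl = subst (ℚ._< p ℚ.+ d) (ℚ.+-identityʳ p) (ℚ.+-monoʳ-< p 0<d)

p≤∣p∣ : ∀ p → p ℚ.≤ ℚ.∣ p ∣
p≤∣p∣ p with ℚ.≤-total 0ℚ p
... | inj₁ 0≤p = ℚ.≤-reflexive (sym (ℚ.0≤p⇒∣p∣≡p 0≤p))
... | inj₂ p≤0 = ℚ.≤-trans p≤0 (ℚ.0≤∣p∣ p)

∣p-q∣<r⇒p<q+r : ∀ p q {r} → ℚ.∣ p ℚ.- q ∣ ℚ.< r → p ℚ.< q ℚ.+ r
∣p-q∣<r⇒p<q+r p q {r} lt = <-by (p<q⇒0<q-p (ℚ.≤-<-trans (p≤∣p∣ (p ℚ.- q)) lt))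
  (solve 3 (λ p q r → p :+ (r :- (p :- q)) := q :+ r) refl p q r)

∣p-q∣<r : ∀ p q {r} → p ℚ.< q ℚ.+ r → q ℚ.< p ℚ.+ r → ℚ.∣ p ℚ.- q ∣ ℚ.< r
∣p-q∣<r p q {r} p<q+r q<p+r with ℚ.∣p∣≡p∨∣p∣≡-p (p ℚ.- q)
... | inj₁ eq rewrite eq = <-by (p<q⇒0<q-p p<q+r)
  (solve 3 (λ p q r → (p :- q) :+ (q :+ r :- p) := r) refl p q r)
... | inj₂ eq rewrite eq = <-by (p<q⇒0<q-p q<p+r)
  (solve 3 (λ p q r → :- (p :- q) :+ (p :+ r :- q) := r) refl p q r)

half< : ∀ {ε} → 0ℚ ℚ.< ε → half ε ℚ.< ε
half< {ε} 0<ε = <-by (0<half 0<ε) (half+half ε)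

small-multiple : ∀ B ε → 0ℚ ℚ.< ε → ∃ λ δ → 0ℚ ℚ.< δ × B ℚ.* δ ℚ.≤ ε
small-multiple B ε 0<ε = let K , small = scale B ε 0<ε in unit K , 0<unit K , small K ℕ.≤-refl

-- The ordered ring ℝ

-- Real arguments are explicit throughout: _≈_ and _≤_ unfold to statements
-- about seq, from which the cauchy component cannot be inferred.

Eventually : (ℕ → Set) → Set
Eventually P = ∃ λ N → ∀ n → N ℕ.≤ n → P n

both : ∀ {P Q R : ℕ → Set} → (∀ n → P n → Q n → R n) → Eventually P → Eventually Q → Eventually R
both f (M , p) (N , q) = M ℕ.⊔ N , λ n le → f n (p n (ℕ.m⊔n≤o⇒m≤o M N le)) (q n (ℕ.m⊔n≤o⇒n≤o M N le))

eventually-map : ∀ {P Q : ℕ → Set} → (∀ n → P n → Q n) → Eventually P → Eventually Q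
eventually-map f (N , p) = N , λ n le → f n (p n le)

eventually-witness : ∀ {P : ℕ → Set} → Eventually P → ∃ P
eventually-witness (N , p) = N , p N ℕ.≤-refl

≤-intro : ∀ x y → (∀ ε → 0ℚ ℚ.< ε → Eventually λ n → seq x n ℚ.≤ seq y n ℚ.+ ε) → x ≤ y
≤-intro x y h ε 0<ε = eventually-map
  (λ n le → ℚ.≤-<-trans le (ℚ.+-monoʳ-< (seq y n) (half< 0<ε))) (h (half ε) (0<half 0<ε))

eventually-≤ : ∀ x y → Eventually (λ n → seq x n ℚ.≤ seq y n) → x ≤ y
eventually-≤ x y x≤y = ≤-intro x y λ ε 0<ε → eventually-map
  (λ n le → ℚ.≤-trans le (≤-by (ℚ.<⇒≤ 0<ε) refl)) x≤y

≤-trans : ∀ x y z → x ≤ y → y ≤ z → x ≤ z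
≤-trans x y z x≤y y≤z ε 0<ε = both
  (λ n p q → <-by (ℚ.+-mono-< (p<q⇒0<q-p p) (p<q⇒0<q-p q))
    (solve 4 (λ a b c e → a :+ ((b :+ con ½ :* e :- a) :+ (c :+ con ½ :* e :- b)) := c :+ e) refl
      (seq x n) (seq y n) (seq z n) ε))
  (x≤y (half ε) (0<half 0<ε)) (y≤z (half ε) (0<half 0<ε))

≈-sym : ∀ x y → x ≈ y → y ≈ x
≈-sym x y x≈y ε 0<ε = eventually-map
  (λ n → subst (ℚ._< ε) (∣p-q∣-sym (seq x n) (seq y n))) (x≈y ε 0<ε)

≈⇒≤ : ∀ x y → x ≈ y → x ≤ y
≈⇒≤ x y x≈y ε 0<ε = eventually-map (λ n → ∣p-q∣<r⇒p<q+r (seq x n) (seq y n)) (x≈y ε 0<ε)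

-- Transitivity of `≈` and its compatibility with sum and negation are inherited from the order
-- through this lemma.
≤-antisym : ∀ x y → x ≤ y → y ≤ x → x ≈ y
≤-antisym x y x≤y y≤x ε 0<ε = both (λ n → ∣p-q∣<r (seq x n) (seq y n)) (x≤y ε 0<ε) (y≤x ε 0<ε)

≈-trans : ∀ x y z → x ≈ y → y ≈ z → x ≈ z
≈-trans x y z x≈y y≈z = ≤-antisym x z
  (≤-trans x y z (≈⇒≤ x y x≈y) (≈⇒≤ y z y≈z))
  (≤-trans z y x (≈⇒≤ z y (≈-sym y z y≈z)) (≈⇒≤ y x (≈-sym x y x≈y)))

pointwise-≈ : ∀ x y → (∀ n → seq x n ≡ seq y n) → x ≈ y
pointwise-≈ x y x≡y ε 0<ε = 0 , λ n _ →
  subst (ℚ._< ε) (sym (cong ℚ.∣_∣ (trans (cong (ℚ._- seq y n) (x≡y n)) (ℚ.+-inverseʳ (seq y n))))) 0<ε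

≈-refl : ∀ x → x ≈ x
≈-refl x = pointwise-≈ x x (λ _ → refl)

≤-poset : Poset 0ℓ 0ℓ 0ℓ
≤-poset = record
  { Carrier = ℝ ; _≈_ = _≈_ ; _≤_ = _≤_
  ; isPartialOrder = record
    { isPreorder = record
      { isEquivalence = record
        { refl = λ {x} → ≈-refl x ; sym = λ {x y} → ≈-sym x y ; trans = λ {x y z} → ≈-trans x y z }
      ; reflexive = λ {x y} → ≈⇒≤ x y
      ; trans = λ {x y z} → ≤-trans x y z }
    ; antisym = λ {x y} → ≤-antisym x y } }

-- The strict relation of a poset is `≤` without `≈`, which does not provide the positive gap of
-- `_<_`; its steps are hidden.
module ℝ-Reasoning where
  open import Relation.Binary.Reasoning.PartialOrder ≤-poset public
    hiding (step-<; begin-strict_)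

+-mono-≤ : ∀ x x′ y y′ → x ≤ x′ → y ≤ y′ → x + y ≤ x′ + y′
+-mono-≤ x x′ y y′ x≤x′ y≤y′ ε 0<ε = both
  (λ n p q → <-by (ℚ.+-mono-< (p<q⇒0<q-p p) (p<q⇒0<q-p q))
    (solve 5 (λ a b c d e → (a :+ c) :+ ((b :+ con ½ :* e :- a) :+ (d :+ con ½ :* e :- c)) := (b :+ d) :+ e)
      refl (seq x n) (seq x′ n) (seq y n) (seq y′ n) ε))
  (x≤x′ (half ε) (0<half 0<ε)) (y≤y′ (half ε) (0<half 0<ε))

neg-antimono-≤ : ∀ x y → x ≤ y → - y ≤ - x
neg-antimono-≤ x y x≤y ε 0<ε = eventually-map
  (λ n p → <-by (p<q⇒0<q-p p)
    (solve 3 (λ a b e → :- b :+ (b :+ e :- a) := :- a :+ e) refl (seq x n) (seq y n) ε))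
  (x≤y ε 0<ε)

+-cong : ∀ x x′ y y′ → x ≈ x′ → y ≈ y′ → x + y ≈ x′ + y′
+-cong x x′ y y′ p q = ≤-antisym (x + y) (x′ + y′)
  (+-mono-≤ x x′ y y′ (≈⇒≤ x x′ p) (≈⇒≤ y y′ q))
  (+-mono-≤ x′ x y′ y (≈⇒≤ x′ x (≈-sym x x′ p)) (≈⇒≤ y′ y (≈-sym y y′ q)))

-‿cong : ∀ x y → x ≈ y → - x ≈ - y
-‿cong x y p = ≤-antisym (- x) (- y)
  (neg-antimono-≤ y x (≈⇒≤ y x (≈-sym x y p))) (neg-antimono-≤ x y (≈⇒≤ x y p))

*-congˡ : ∀ r x y → x ≈ y → r * x ≈ r * y
*-congˡ r x y x≈y ε 0<ε =
  let B , N , 0≤B , ∣r∣≤B = bounded r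
      δ , 0<δ , Bδ≤ = small-multiple B (half ε) (0<half 0<ε)
  in both
    (λ n ∣rₙ∣≤B ∣x-y∣<δ → let a = seq r n ; b = seq x n ; c = seq y n in begin-strict
      ℚ.∣ a ℚ.* b ℚ.- a ℚ.* c ∣
        ≡⟨ cong ℚ.∣_∣ (solve 3 (λ a b c → a :* b :- a :* c := a :* (b :- c)) refl a b c) ⟩
      ℚ.∣ a ℚ.* (b ℚ.- c) ∣             ≡⟨ ℚ.∣p*q∣≡∣p∣*∣q∣ a (b ℚ.- c) ⟩
      ℚ.∣ a ∣ ℚ.* ℚ.∣ b ℚ.- c ∣         ≤⟨ *-mono (ℚ.0≤∣p∣ a) (ℚ.<⇒≤ 0<δ) ∣rₙ∣≤B (ℚ.<⇒≤ ∣x-y∣<δ) ⟩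
      B ℚ.* δ                           ≤⟨ Bδ≤ ⟩
      half ε                            <⟨ half< 0<ε ⟩
      ε ∎)
    (N , ∣r∣≤B) (x≈y δ 0<δ)
  where open ℚ.≤-Reasoning

*-comm : ∀ x y → x * y ≈ y * x
*-comm x y = pointwise-≈ (x * y) (y * x) (λ n → ℚ.*-comm (seq x n) (seq y n))

*-cong : ∀ x x′ y y′ → x ≈ x′ → y ≈ y′ → x * y ≈ x′ * y′
*-cong x x′ y y′ p q = begin-equality
  x * y    ≈⟨ *-congˡ x y y′ q ⟩
  x * y′   ≈⟨ *-comm x y′ ⟩
  y′ * x   ≈⟨ *-congˡ y′ x x′ p ⟩
  y′ * x′  ≈⟨ *-comm y′ x′ ⟩
  x′ * y′  ∎
  where open ℝ-Reasoning

-- Every term of `r * r` is nonnegative, so termwise inequalities survive multiplication. The bound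
-- `B` on `r * r` keeps the slack `δ` below `ε`.
square-*-mono-≤ : ∀ r x y → x ≤ y → (r * r) * x ≤ (r * r) * y
square-*-mono-≤ r x y x≤y = ≤-intro (r * r * x) (r * r * y) λ ε 0<ε →
  let B , N , 0≤B , ∣r²∣≤B = bounded (r * r)
      δ , 0<δ , Bδ≤ε = small-multiple B ε 0<ε
  in both
    (λ n ∣r²∣≤B x<y+δ → let a = seq r n ; b = seq x n ; c = seq y n in begin
      a ℚ.* a ℚ.* b                      ≤⟨ *-monoˡ (0≤square a) (ℚ.<⇒≤ x<y+δ) ⟩
      a ℚ.* a ℚ.* (c ℚ.+ δ)              ≡⟨ ℚ.*-distribˡ-+ (a ℚ.* a) c δ ⟩
      a ℚ.* a ℚ.* c ℚ.+ a ℚ.* a ℚ.* δ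
        ≤⟨ ℚ.+-monoʳ-≤ (a ℚ.* a ℚ.* c) (*-monoʳ (ℚ.<⇒≤ 0<δ) (ℚ.≤-trans (p≤∣p∣ (a ℚ.* a)) ∣r²∣≤B)) ⟩
      a ℚ.* a ℚ.* c ℚ.+ B ℚ.* δ          ≤⟨ ℚ.+-monoʳ-≤ (a ℚ.* a ℚ.* c) Bδ≤ε ⟩
      a ℚ.* a ℚ.* c ℚ.+ ε ∎)
    (N , ∣r²∣≤B) (x≤y δ 0<δ)
  where
  open ℚ.≤-Reasoning
  0≤square : ∀ a → 0ℚ ℚ.≤ a ℚ.* a
  0≤square a with ℚ.≤-total 0ℚ a
  ... | inj₁ 0≤a = 0≤* 0≤a 0≤a
  ... | inj₂ a≤0 = subst (0ℚ ℚ.≤_) (solve 1 (λ a → :- a :* :- a := a :* a) refl a)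
                     (0≤* (ℚ.neg-antimono-≤ a≤0) (ℚ.neg-antimono-≤ a≤0))

≤⇒≯ : ∀ x y → x ≤ y → ¬ (y < x)
≤⇒≯ x y x≤y (ε , 0<ε , y<x) =
  let n , p , q = eventually-witness (both (λ n p q → p , q) (x≤y ε 0<ε) y<x)
  in ℚ.<-asym p q

-- Constructively valid: comparing one sufficiently late term of each Cauchy
-- sequence decides between y < x and x ≤ y + ε.
≮⇒≥ : ∀ x y → ¬ (y < x) → x ≤ y
≮⇒≥ x y y≮x ε 0<ε = compare (p ℚ.<? q ℚ.+ half ε)
  where
  -- `θ` is ε/8. Passing from the index `P` to `n` in both sequences costs less than 2θ. In the
  -- first case ε/2 + 2θ is below `ε`; in the second a gap above ε/2 - 2θ = 2θ remains, of which `θ`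
  -- is the witness.
  θ = half (half (half ε))
  0<θ = 0<half (0<half (0<half 0<ε))
  M = proj₁ (cauchy x θ 0<θ)
  N = proj₁ (cauchy y θ 0<θ)
  P = M ℕ.⊔ N
  p = seq x P
  q = seq y P
  x-near : ∀ n → P ℕ.≤ n → ℚ.∣ seq x n ℚ.- p ∣ ℚ.< θ
  x-near n le = proj₂ (cauchy x θ 0<θ) n P (ℕ.m⊔n≤o⇒m≤o M N le) (ℕ.m≤m⊔n M N)
  y-near : ∀ n → P ℕ.≤ n → ℚ.∣ seq y n ℚ.- q ∣ ℚ.< θ
  y-near n le = proj₂ (cauchy y θ 0<θ) n P (ℕ.m⊔n≤o⇒n≤o M N le) (ℕ.m≤n⊔m M N)
  compare : Dec (p ℚ.< q ℚ.+ half ε) → Eventually λ n → seq x n ℚ.< seq y n ℚ.+ ε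
  compare (yes p<q+) = P , λ n le → <-by
    (ℚ.+-mono-< (ℚ.+-mono-< 0<θ 0<θ) (ℚ.+-mono-< (p<q⇒0<q-p p<q+)
      (ℚ.+-mono-< (p<q⇒0<q-p (∣p-q∣<r⇒p<q+r (seq x n) p (x-near n le)))
        (p<q⇒0<q-p (∣p-q∣<r⇒p<q+r q (seq y n) (subst (ℚ._< θ) (∣p-q∣-sym (seq y n) q) (y-near n le)))))))
    (solve 5 (λ a b p q e → let k = con ½ :* (con ½ :* (con ½ :* e)) in
       a :+ ((k :+ k) :+ ((q :+ con ½ :* e :- p) :+ ((p :+ k :- a) :+ (b :+ k :- q)))) := b :+ e)
      refl (seq x n) (seq y n) p q ε)
  compare (no p≮q+) = contradiction
    (θ , 0<θ , P , λ n le → <-by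
      (ℚ.+-mono-<-≤ 0<θ (ℚ.+-mono-≤ (p≤q⇒0≤q-p (ℚ.≮⇒≥ p≮q+))
        (ℚ.<⇒≤ (ℚ.+-mono-< (p<q⇒0<q-p (∣p-q∣<r⇒p<q+r (seq y n) q (y-near n le)))
          (p<q⇒0<q-p (∣p-q∣<r⇒p<q+r p (seq x n) (subst (ℚ._< θ) (∣p-q∣-sym (seq x n) p) (x-near n le))))))))
      (solve 5 (λ a b p q e → let k = con ½ :* (con ½ :* (con ½ :* e)) in
         b :+ k :+ (k :+ ((p :- (q :+ con ½ :* e)) :+ ((q :+ k :- b) :+ (a :+ k :- p)))) := a)
        refl (seq x n) (seq y n) p q ε))
    y≮x

-- The exponential function

exp-homo-+ : ∀ x y → exp (x + y) ≈ exp x * exp y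
exp-homo-+ x y ε 0<ε =
  let A , I , 0≤A , ∣x∣≤A = bounded x
      B , J , 0≤B , ∣y∣≤B = bounded y
      M , small = Tail.tail (A ℚ.+ B) (0≤+ 0≤A 0≤B) (half ε) (0<half 0<ε)
      S-mono : ∀ n → M ℕ.≤ n → S (A ℚ.+ B) M ℚ.≤ S (A ℚ.+ B) n
      S-mono n M≤n = S-monoʳ (0≤+ 0≤A 0≤B) (ℕ.≤⇒≤′ M≤n)
  in both
    (λ n (∣xₙ∣≤A , ∣yₙ∣≤B) M≤n → let a = seq x n ; b = seq y n ; C = A ℚ.+ B in begin-strict
      ℚ.∣ seq (exp (x + y)) n ℚ.- seq (exp x) n ℚ.* seq (exp y) n ∣
        ≡⟨ cong ℚ.∣_∣ (cong₂ ℚ._-_ (seq-exp (x + y) n) (cong₂ ℚ._*_ (seq-exp x n) (seq-exp y n))) ⟩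
      ℚ.∣ S (a ℚ.+ b) n ℚ.- S a n ℚ.* S b n ∣    ≡⟨ ∣p-q∣-sym (S (a ℚ.+ b) n) (S a n ℚ.* S b n) ⟩
      ℚ.∣ S a n ℚ.* S b n ℚ.- S (a ℚ.+ b) n ∣    ≤⟨ S-homo-+ ∣xₙ∣≤A ∣yₙ∣≤B n ⟩
      S C (n ℕ.+ n) ℚ.- S C n
        -- `small` bounds differences from the fixed index `M`; since the sums for `C` increase, the
        -- block from `n` to `n + n` is no larger.
        ≤⟨ ℚ.+-monoʳ-≤ (S C (n ℕ.+ n)) (ℚ.neg-antimono-≤ (S-mono n M≤n)) ⟩
      S C (n ℕ.+ n) ℚ.- S C M                    ≤⟨ small (n ℕ.+ n) (ℕ.≤-trans M≤n (ℕ.m≤m+n n n)) ⟩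
      half ε                                     <⟨ half< 0<ε ⟩
      ε ∎)
    (both (λ n → _,_) (I , ∣x∣≤A) (J , ∣y∣≤B)) (M , λ n le → le)
  where
  open ℚ.≤-Reasoning

-- The rearrangements of arguments on the way to monotonicity hold term by term; `exp-cong` itself
-- is deduced from monotonicity.
exp-cong-pointwise : ∀ x y → (∀ n → seq x n ≡ seq y n) → exp x ≈ exp y
exp-cong-pointwise x y x≡y = pointwise-≈ (exp x) (exp y)
  (λ n → trans (seq-exp x n) (trans (cong (λ a → S a n) (x≡y n)) (sym (seq-exp y n))))

1+q≤S : ∀ {q} → 0ℚ ℚ.≤ q → ∀ n → 1ℚ ℚ.+ q ℚ.≤ S q (suc n)
1+q≤S {q} 0≤q n = ℚ.≤-trans
  (ℚ.≤-reflexive (solve 1 (λ q → con 1ℚ :+ q := con 1ℚ :+ con 1ℚ :* (q :* con (unit 0))) refl q))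
  (S-monoʳ 0≤q {1} {suc n} (ℕ.≤⇒≤′ (ℕ.s≤s ℕ.z≤n)))

S-0 : ∀ n → S 0ℚ n ≡ 1ℚ
S-0 zero    = refl
S-0 (suc n) = trans (cong₂ ℚ._+_ (S-0 n) (trans (cong (t 0ℚ n ℚ.*_) (ℚ.*-zeroˡ (unit n))) (ℚ.*-zeroʳ (t 0ℚ n)))) refl

exp-0 : ∀ x → (∀ n → seq x n ≡ 0ℚ) → exp x ≈ 1ℝ
exp-0 x x≡0 = pointwise-≈ (exp x) 1ℝ (λ n → trans (seq-exp x n) (trans (cong (λ a → S a n) (x≡0 n)) (S-0 n)))

exp*exp-neg : ∀ x → exp x * exp (- x) ≈ 1ℝ
exp*exp-neg x = begin-equality
  exp x * exp (- x)   ≈⟨ exp-homo-+ x (- x) ⟨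
  exp (x - x)         ≈⟨ exp-0 (x - x) (λ n → ℚ.+-inverseʳ (seq x n)) ⟩
  1ℝ ∎
  where open ℝ-Reasoning

-- Makes `square-*-mono-≤` applicable to the factor `exp x` before its sign is known.
exp-square : ∀ x → exp x ≈ exp (fromℚ ½ * x) * exp (fromℚ ½ * x)
exp-square x = begin-equality
  exp x            ≈⟨ exp-cong-pointwise x (y + y) (λ n → sym (half+half (seq x n))) ⟩
  exp (y + y)      ≈⟨ exp-homo-+ y y ⟩
  exp y * exp y    ∎
  where
  open ℝ-Reasoning
  y = fromℚ ½ * x

exp-*-mono-≤ : ∀ w x y → x ≤ y → exp w * x ≤ exp w * y
exp-*-mono-≤ w x y x≤y = begin
  exp w * x      ≈⟨ *-cong (exp w) (s * s) x x (exp-square w) (≈-refl x) ⟩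
  (s * s) * x    ≤⟨ square-*-mono-≤ s x y x≤y ⟩
  (s * s) * y    ≈⟨ *-cong (s * s) (exp w) y y (≈-sym (exp w) (s * s) (exp-square w)) (≈-refl y) ⟩
  exp w * y      ∎
  where
  open ℝ-Reasoning
  s = exp (fromℚ ½ * w)

*-identityʳ : ∀ x → x * 1ℝ ≈ x
*-identityʳ x = pointwise-≈ (x * 1ℝ) x (λ n → ℚ.*-identityʳ (seq x n))

0≤exp : ∀ x → 0ℝ ≤ exp x
0≤exp x = begin
  0ℝ           ≈⟨ pointwise-≈ 0ℝ (exp x * 0ℝ) (λ n → sym (ℚ.*-zeroʳ (seq (exp x) n))) ⟩
  exp x * 0ℝ   ≤⟨ exp-*-mono-≤ x 0ℝ 1ℝ (eventually-≤ 0ℝ 1ℝ (0 , λ _ _ → ℚ.nonNegative⁻¹ 1ℚ)) ⟩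
  exp x * 1ℝ   ≈⟨ *-identityʳ (exp x) ⟩
  exp x        ∎
  where open ℝ-Reasoning

-- A power of `δ` with positive exponent is at most `δ`, because `δ ≤ 1`.
t-scale : ∀ {δ} → 0ℚ ℚ.≤ δ → δ ℚ.≤ 1ℚ → ∀ k → t δ (suc k) ℚ.≤ δ ℚ.* t 1ℚ (suc k)
t-scale {δ} 0≤δ δ≤1 zero = ℚ.≤-reflexive
  (solve 1 (λ d → con 1ℚ :* (d :* con (unit 0)) := d :* (con 1ℚ :* (con 1ℚ :* con (unit 0)))) refl δ)
t-scale {δ} 0≤δ δ≤1 (suc k) = ℚ.≤-trans
  (*-mono (Tail.0≤t δ 0≤δ (suc k)) (Tail.0≤Bu 1ℚ (ℚ.nonNegative⁻¹ 1ℚ) (suc k))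
    (t-scale 0≤δ δ≤1 k) (*-monoʳ (ℚ.<⇒≤ (0<unit (suc k))) δ≤1))
  (ℚ.≤-reflexive (ℚ.*-assoc δ (t 1ℚ (suc k)) (1ℚ ℚ.* unit (suc k))))

S-1≤ : ∀ {δ} → 0ℚ ℚ.≤ δ → δ ℚ.≤ 1ℚ → ∀ n → S δ n ℚ.- 1ℚ ℚ.≤ δ ℚ.* S 1ℚ n
S-1≤ {δ} 0≤δ δ≤1 zero = subst (0ℚ ℚ.≤_) (sym (ℚ.*-identityʳ δ)) 0≤δ
S-1≤ {δ} 0≤δ δ≤1 (suc n) = begin
  S δ n ℚ.+ t δ (suc n) ℚ.- 1ℚ               ≡⟨ solve 2 (λ a b → a :+ b :- con 1ℚ := a :- con 1ℚ :+ b) refl (S δ n) (t δ (suc n)) ⟩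
  S δ n ℚ.- 1ℚ ℚ.+ t δ (suc n)               ≤⟨ ℚ.+-mono-≤ (S-1≤ 0≤δ δ≤1 n) (t-scale 0≤δ δ≤1 n) ⟩
  δ ℚ.* S 1ℚ n ℚ.+ δ ℚ.* t 1ℚ (suc n)        ≡⟨ ℚ.*-distribˡ-+ δ (S 1ℚ n) (t 1ℚ (suc n)) ⟨
  δ ℚ.* S 1ℚ (suc n) ∎
  where open ℚ.≤-Reasoning

-- Continuity of `exp` at 0 with an explicit modulus: past the constant term the series for `q` is
-- dominated by that for `δ`, hence by `δ` times sums that stay bounded.
1-S≤ : ∀ {q δ} → ℚ.∣ q ∣ ℚ.≤ δ → δ ℚ.≤ 1ℚ → ∀ n → 1ℚ ℚ.- S q n ℚ.≤ δ ℚ.* S 1ℚ n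
1-S≤ {q} {δ} ∣q∣≤δ δ≤1 n = begin
  1ℚ ℚ.- S q n               ≤⟨ p≤∣p∣ (1ℚ ℚ.- S q n) ⟩
  ℚ.∣ 1ℚ ℚ.- S q n ∣         ≡⟨ ∣p-q∣-sym 1ℚ (S q n) ⟩
  ℚ.∣ S q n ℚ.- 1ℚ ∣         ≡⟨ cong (λ p → ℚ.∣ p ℚ.- 1ℚ ∣) (S≡∑t q n) ⟩
  ℚ.∣ ∑ (t q) n ℚ.- 1ℚ ∣     ≤⟨ ∑-difference (t-⊑ ∣q∣≤δ) {0} {n} (ℕ.≤⇒≤′ ℕ.z≤n) ⟩
  ∑ (t δ) n ℚ.- 1ℚ           ≡⟨ cong (ℚ._- 1ℚ) (S≡∑t δ n) ⟨
  S δ n ℚ.- 1ℚ               ≤⟨ S-1≤ (ℚ.≤-trans (ℚ.0≤∣p∣ q) ∣q∣≤δ) δ≤1 n ⟩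
  δ ℚ.* S 1ℚ n ∎
  where open ℚ.≤-Reasoning

-- Abstract, lest type checking normalise the numerical bound.
abstract
  S-1-bounded : ∃ λ C → 0ℚ ℚ.≤ C × Eventually λ n → S 1ℚ n ℚ.≤ C
  S-1-bounded = let C , N , 0≤C , ∣e∣≤C = bounded (exp 1ℝ) in C , 0≤C , N , λ n N≤n →
    ℚ.≤-trans (p≤∣p∣ (S 1ℚ n)) (subst (λ s → ℚ.∣ s ∣ ℚ.≤ C) (seq-exp 1ℝ n) (∣e∣≤C n N≤n))

-- Terms of a sequence representing z ≥ 0 may be slightly negative.
1≤exp : ∀ z → 0ℝ ≤ z → 1ℝ ≤ exp z
1≤exp z 0≤z = ≤-intro 1ℝ (exp z) λ ε 0<ε →
  let C , 0≤C , S≤C = S-1-bounded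
      δ₁ , 0<δ₁ , Cδ₁≤ε = small-multiple C ε 0<ε
      -- `δ ≤ δ₁` brings the error `δ * C` below `ε`, and `δ ≤ 1ℚ` is the condition of `1-S≤`.
      δ = δ₁ ℚ.⊓ 1ℚ
      0<δ : 0ℚ ℚ.< δ
      0<δ = ⊓-pos 0<δ₁ (ℚ.positive⁻¹ 1ℚ)
  in both
    (λ n Sₙ≤C 0<zₙ+δ → subst (λ s → 1ℚ ℚ.≤ s ℚ.+ ε) (sym (seq-exp z n))
      (bound 0≤C (ℚ.<⇒≤ 0<ε) (ℚ.p⊓q≤p δ₁ 1ℚ) (ℚ.p⊓q≤q δ₁ 1ℚ) Cδ₁≤ε n Sₙ≤C
        (seq z n) (ℚ.<⇒≤ 0<zₙ+δ)))
    S≤C (0≤z δ 0<δ)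
  where
  open ℚ.≤-Reasoning
  ⊓-pos : ∀ {p q} → 0ℚ ℚ.< p → 0ℚ ℚ.< q → 0ℚ ℚ.< p ℚ.⊓ q
  ⊓-pos {p} {q} 0<p 0<q with ℚ.⊓-sel p q
  ... | inj₁ eq = subst (0ℚ ℚ.<_) (sym eq) 0<p
  ... | inj₂ eq = subst (0ℚ ℚ.<_) (sym eq) 0<q
  bound : ∀ {C ε δ δ₁} → 0ℚ ℚ.≤ C → 0ℚ ℚ.≤ ε → δ ℚ.≤ δ₁ → δ ℚ.≤ 1ℚ → C ℚ.* δ₁ ℚ.≤ ε →
    ∀ n → S 1ℚ n ℚ.≤ C → ∀ q → 0ℚ ℚ.≤ q ℚ.+ δ → 1ℚ ℚ.≤ S q n ℚ.+ ε
  bound {C} {ε} {δ} {δ₁} 0≤C 0≤ε δ≤δ₁ δ≤1 Cδ₁≤ε n S≤C q -δ≤q with ℚ.≤-total 0ℚ q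
  ... | inj₁ 0≤q = ℚ.≤-trans (S-monoʳ {q} 0≤q {0} {n} (ℕ.≤⇒≤′ ℕ.z≤n)) (≤-by {S q n} 0≤ε refl)
  ... | inj₂ q≤0 = ≤-by (p≤q⇒0≤q-p (begin
      1ℚ ℚ.- S q n     ≤⟨ 1-S≤ ∣q∣≤δ δ≤1 n ⟩
      δ ℚ.* S 1ℚ n     ≤⟨ *-mono 0≤δ 0≤C ℚ.≤-refl S≤C ⟩
      δ ℚ.* C          ≤⟨ *-monoʳ 0≤C δ≤δ₁ ⟩
      δ₁ ℚ.* C         ≡⟨ ℚ.*-comm δ₁ C ⟩
      C ℚ.* δ₁         ≤⟨ Cδ₁≤ε ⟩
      ε                ∎))
    (solve 2 (λ s e → con 1ℚ :+ (e :- (con 1ℚ :- s)) := s :+ e) refl (S q n) ε)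
    where
    ∣q∣≤δ : ℚ.∣ q ∣ ℚ.≤ δ
    ∣q∣≤δ = subst (ℚ._≤ δ) {ℚ.- q} {ℚ.∣ q ∣} (trans (sym (ℚ.0≤p⇒∣p∣≡p (ℚ.neg-antimono-≤ q≤0))) (ℚ.∣-p∣≡∣p∣ q))
      (≤-by -δ≤q (solve 2 (λ q d → :- q :+ (q :+ d) := d) refl q δ))
    0≤δ : 0ℚ ℚ.≤ δ
    0≤δ = ℚ.≤-trans (ℚ.0≤∣p∣ q) ∣q∣≤δ

exp-difference : ∀ x y → exp y ≈ exp x * exp (y - x)
exp-difference x y = begin-equality
  exp y               ≈⟨ exp-cong-pointwise y (x + (y - x))
                           (λ n → solve 2 (λ a b → b := a :+ (b :- a)) refl (seq x n) (seq y n)) ⟩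
  exp (x + (y - x))   ≈⟨ exp-homo-+ x (y - x) ⟩
  exp x * exp (y - x) ∎
  where open ℝ-Reasoning

exp-mono-≤ : ∀ x y → x ≤ y → exp x ≤ exp y
exp-mono-≤ x y x≤y = begin
  exp x                ≈⟨ *-identityʳ (exp x) ⟨
  exp x * 1ℝ           ≤⟨ exp-*-mono-≤ x 1ℝ (exp (y - x)) (1≤exp (y - x) 0≤y-x) ⟩
  exp x * exp (y - x)  ≈⟨ exp-difference x y ⟨
  exp y                ∎
  where
  open ℝ-Reasoning
  0≤y-x : 0ℝ ≤ y - x
  0≤y-x = begin
    0ℝ      ≈⟨ pointwise-≈ 0ℝ (x - x) (λ n → sym (ℚ.+-inverseʳ (seq x n))) ⟩
    x - x   ≤⟨ +-mono-≤ x y (- x) (- x) x≤y (≈⇒≤ (- x) (- x) (≈-refl (- x))) ⟩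
    y - x   ∎

exp-cong : ∀ x y → x ≈ y → exp x ≈ exp y
exp-cong x y x≈y = ≤-antisym (exp x) (exp y)
  (exp-mono-≤ x y (≈⇒≤ x y x≈y)) (exp-mono-≤ y x (≈⇒≤ y x (≈-sym x y x≈y)))

-- If y < x then exp x ≥ (1 + δ) exp y for some δ > 0, and multiplying
-- exp x ≤ exp y by exp (- y) gives the contradiction 1 + δ ≤ 1.
exp-cancel-≤ : ∀ x y → exp x ≤ exp y → x ≤ y
exp-cancel-≤ x y ex≤ey = ≮⇒≥ x y λ (δ , 0<δ , N , y+δ<x) →
  let open ℝ-Reasoning
      E = exp (- y)
      1+δ≤ : fromℚ (1ℚ ℚ.+ δ) ≤ exp (x - y)
      1+δ≤ = eventually-≤ (fromℚ (1ℚ ℚ.+ δ)) (exp (x - y)) (both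
        (λ n → λ { y+δ<xₙ (ℕ.s≤s {n = m} _) → subst (1ℚ ℚ.+ δ ℚ.≤_) (sym (seq-exp (x - y) n))
          (ℚ.≤-trans (≤-by (ℚ.<⇒≤ (p<q⇒0<q-p y+δ<xₙ))
              (solve 3 (λ a b d → con 1ℚ :+ d :+ (a :- (b :+ d)) := con 1ℚ :+ (a :- b)) refl (seq x n) (seq y n) δ))
            (1+q≤S (≤-by (ℚ.<⇒≤ (ℚ.+-mono-< 0<δ (p<q⇒0<q-p y+δ<xₙ)))
              (solve 3 (λ a b d → con 0ℚ :+ (d :+ (a :- (b :+ d))) := a :- b) refl (seq x n) (seq y n) δ)) m)) })
        -- Index 0 is left out, as the partial sum there lacks the linear term.
        (N , y+δ<x) (1 , λ n le → le))
  in ≤⇒≯ (fromℚ (1ℚ ℚ.+ δ)) 1ℝ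
    (begin
      fromℚ (1ℚ ℚ.+ δ)      ≤⟨ 1+δ≤ ⟩
      exp (x - y)           ≈⟨ exp-homo-+ x (- y) ⟩
      exp x * E             ≈⟨ *-comm (exp x) E ⟩
      E * exp x             ≤⟨ exp-*-mono-≤ (- y) (exp x) (exp y) ex≤ey ⟩
      E * exp y             ≈⟨ *-comm E (exp y) ⟩
      exp y * E             ≈⟨ exp*exp-neg y ⟩
      1ℝ ∎)
    (half δ , 0<half 0<δ , 0 , λ _ _ → ℚ.+-monoʳ-< 1ℚ (half< 0<δ))

-- exp x is bounded by some B, hence its inverse exp (- x) by about 1 / B
-- from below.
0<exp-neg : ∀ x → 0ℝ < exp (- x)
0<exp-neg x =
  let B , N , 0≤B , ∣e∣≤B = bounded (exp x)
      -- If a late term f of `exp (- x)` were at most `c`, then, as f > -c, its product with the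
      -- term e of `exp x` would be at most ½; but e f > ½, because the product of the two reals is
      -- 1.
      c , 0<c , Bc≤½ = small-multiple B ½ (ℚ.positive⁻¹ ½)
  in half c , 0<half 0<c , both
    (λ n ∣eₙ∣≤B (0<f+c , 1<ef+½) → ℚ.≤-<-trans (ℚ.≤-reflexive (ℚ.+-identityˡ (half c)))
      (ℚ.<-trans (half< 0<c) (ℚ.≰⇒> λ f≤c → ℚ.<-irrefl refl (ℚ.<-≤-trans 1<ef+½
        (let e = seq (exp x) n ; f = seq (exp (- x)) n
             ∣f∣≤c = ∣p∣≤ (ℚ.<⇒≤ 0<f+c) f≤c
         in begin
          e ℚ.* f ℚ.+ ½                   ≤⟨ ℚ.+-monoˡ-≤ ½ (p≤∣p∣ (e ℚ.* f)) ⟩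
          ℚ.∣ e ℚ.* f ∣ ℚ.+ ½             ≡⟨ cong (ℚ._+ ½) (ℚ.∣p*q∣≡∣p∣*∣q∣ e f) ⟩
          ℚ.∣ e ∣ ℚ.* ℚ.∣ f ∣ ℚ.+ ½       ≤⟨ ℚ.+-monoˡ-≤ ½ (*-mono (ℚ.0≤∣p∣ e) (ℚ.<⇒≤ 0<c) ∣eₙ∣≤B ∣f∣≤c) ⟩
          B ℚ.* c ℚ.+ ½                   ≤⟨ ℚ.+-monoˡ-≤ ½ Bc≤½ ⟩
          1ℚ ∎)))))
    (N , ∣e∣≤B)
    (both (λ n → _,_) (0≤exp (- x) c 0<c)
      (≈⇒≤ 1ℝ (exp x * exp (- x)) (≈-sym (exp x * exp (- x)) 1ℝ (exp*exp-neg x)) ½ (ℚ.positive⁻¹ ½)))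
  where
  open ℚ.≤-Reasoning
  ∣p∣≤ : ∀ {p c} → 0ℚ ℚ.≤ p ℚ.+ c → p ℚ.≤ c → ℚ.∣ p ∣ ℚ.≤ c
  ∣p∣≤ {p} {c} -c≤p p≤c with ℚ.∣p∣≡p∨∣p∣≡-p p
  ... | inj₁ eq = subst (ℚ._≤ c) (sym eq) p≤c
  ... | inj₂ eq = subst (ℚ._≤ c) (sym eq) (≤-by -c≤p (solve 2 (λ p c → :- p :+ (p :+ c) := c) refl p c))

-- Values at 1

+-cancelˡ-0 : ∀ x y → x ≈ x + y → 0ℝ ≈ y
+-cancelˡ-0 x y x≈x+y = begin-equality
  0ℝ               ≈⟨ pointwise-≈ 0ℝ (- x + x) (λ n → sym (ℚ.+-inverseˡ (seq x n))) ⟩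
  - x + x          ≈⟨ +-cong (- x) (- x) x (x + y) (≈-refl (- x)) x≈x+y ⟩
  - x + (x + y)    ≈⟨ pointwise-≈ (- x + (x + y)) y (λ n → solve 2 (λ a b → :- a :+ (a :+ b) := b) refl (seq x n) (seq y n)) ⟩
  y                ∎
  where open ℝ-Reasoning

additive-1 : ∀ f → Additive f → f 1 ≈ 0ℝ
additive-1 f f-add = ≈-sym 0ℝ (f 1) (+-cancelˡ-0 (f 1) (f 1) (f-add 1 1 (1-coprimeTo 1)))

-- Cancelling a factor of size at least 1/4 magnifies an error at most fourfold, so the product is
-- taken within ε/4.
*-cancelˡ-0 : ∀ x y → Eventually (λ n → ½ ℚ.* ½ ℚ.≤ ℚ.∣ seq x n ∣) → x * y ≈ 0ℝ → y ≈ 0ℝ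
*-cancelˡ-0 x y x-apart xy≈0 ε 0<ε = both
  (λ n ¼≤∣x∣ ∣xy∣<ε/4 → let a = seq x n ; b = seq y n in
    ℚ.*-cancelˡ-<-nonNeg (½ ℚ.* ½) (begin-strict
      ½ ℚ.* ½ ℚ.* ℚ.∣ b ℚ.- 0ℚ ∣      ≡⟨ cong (λ p → ½ ℚ.* ½ ℚ.* ℚ.∣ p ∣) (ℚ.+-identityʳ b) ⟩
      ½ ℚ.* ½ ℚ.* ℚ.∣ b ∣             ≤⟨ *-monoʳ (ℚ.0≤∣p∣ b) ¼≤∣x∣ ⟩
      ℚ.∣ a ∣ ℚ.* ℚ.∣ b ∣             ≡⟨ ℚ.∣p*q∣≡∣p∣*∣q∣ a b ⟨
      ℚ.∣ a ℚ.* b ∣                   ≡⟨ cong ℚ.∣_∣ (ℚ.+-identityʳ (a ℚ.* b)) ⟨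
      ℚ.∣ a ℚ.* b ℚ.- 0ℚ ∣            <⟨ ∣xy∣<ε/4 ⟩
      half (half ε)                   ≡⟨ ℚ.*-assoc ½ ½ ε ⟨
      ½ ℚ.* ½ ℚ.* ε ∎))
  x-apart (xy≈0 (half (half ε)) (0<half (0<half 0<ε)))
  where open ℚ.≤-Reasoning

-- One term known to within 1/4 decides: if it is at least ½, later terms stay above 1/4; if it is
-- at most ½, they stay below 3/4.
apart-0-or-1 : ∀ x →
  Eventually (λ n → ½ ℚ.* ½ ℚ.≤ ℚ.∣ seq x n ∣) ⊎ Eventually (λ n → ½ ℚ.* ½ ℚ.≤ ℚ.∣ seq (1ℝ - x) n ∣)
apart-0-or-1 x with cauchy x (½ ℚ.* ½) (ℚ.positive⁻¹ (½ ℚ.* ½))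
... | N , near with ℚ.≤-total ½ (seq x N)
... | inj₁ ½≤p = inj₁ (N , λ n N≤n → ℚ.≤-trans
  (≤-by (ℚ.+-mono-≤ (p≤q⇒0≤q-p ½≤p) (ℚ.<⇒≤ (p<q⇒0<q-p (∣p-q∣<r⇒p<q+r (seq x N) (seq x n) (near N n ℕ.≤-refl N≤n)))))
    (solve 2 (λ a p → con (½ ℚ.* ½) :+ ((p :- con ½) :+ (a :+ con (½ ℚ.* ½) :- p)) := a) refl (seq x n) (seq x N)))
  (p≤∣p∣ (seq x n)))
... | inj₂ p≤½ = inj₂ (N , λ n N≤n → ℚ.≤-trans
  (≤-by (ℚ.+-mono-≤ (p≤q⇒0≤q-p p≤½) (ℚ.<⇒≤ (p<q⇒0<q-p (∣p-q∣<r⇒p<q+r (seq x n) (seq x N) (near n N N≤n ℕ.≤-refl)))))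
    (solve 2 (λ a p → con (½ ℚ.* ½) :+ ((con ½ :- p) :+ (p :+ con (½ ℚ.* ½) :- a)) := con 1ℚ :- a) refl (seq x n) (seq x N)))
  (p≤∣p∣ (seq (1ℝ - x) n)))

-- Constructively a vanishing product does not in general reveal which factor is zero. Of `x` and
-- `1ℝ - x`, `apart-0-or-1` finds one that can be cancelled.
idempotent-apart-0 : ∀ x → x ≈ x * x → ¬ (x ≈ 0ℝ) → x ≈ 1ℝ
idempotent-apart-0 x x≈x² x≉0 with apart-0-or-1 x
... | inj₁ x-apart = begin-equality
  x                  ≈⟨ pointwise-≈ x (1ℝ - (1ℝ - x)) (λ n → solve 1 (λ a → a := con 1ℚ :- (con 1ℚ :- a)) refl (seq x n)) ⟩
  1ℝ - (1ℝ - x)      ≈⟨ +-cong 1ℝ 1ℝ (- (1ℝ - x)) (- 0ℝ) (≈-refl 1ℝ) (-‿cong (1ℝ - x) 0ℝ (*-cancelˡ-0 x (1ℝ - x) x-apart x[1-x]≈0)) ⟩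
  1ℝ - 0ℝ            ≈⟨ pointwise-≈ (1ℝ - 0ℝ) 1ℝ (λ _ → refl) ⟩
  1ℝ                 ∎
  where
  open ℝ-Reasoning
  x[1-x]≈0 : x * (1ℝ - x) ≈ 0ℝ
  x[1-x]≈0 = begin-equality
    x * (1ℝ - x)     ≈⟨ pointwise-≈ (x * (1ℝ - x)) (x - x * x) (λ n → solve 1 (λ a → a :* (con 1ℚ :- a) := a :- a :* a) refl (seq x n)) ⟩
    x - x * x        ≈⟨ +-cong x (x * x) (- (x * x)) (- (x * x)) x≈x² (≈-refl (- (x * x))) ⟩
    x * x - x * x    ≈⟨ pointwise-≈ (x * x - x * x) 0ℝ (λ n → ℚ.+-inverseʳ (seq x n ℚ.* seq x n)) ⟩
    0ℝ               ∎
... | inj₂ 1-x-apart = contradiction (*-cancelˡ-0 (1ℝ - x) x 1-x-apart [1-x]x≈0) x≉0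
  where
  open ℝ-Reasoning
  [1-x]x≈0 : (1ℝ - x) * x ≈ 0ℝ
  [1-x]x≈0 = begin-equality
    (1ℝ - x) * x     ≈⟨ pointwise-≈ ((1ℝ - x) * x) (x - x * x) (λ n → solve 1 (λ a → (con 1ℚ :- a) :* a := a :- a :* a) refl (seq x n)) ⟩
    x - x * x        ≈⟨ +-cong x (x * x) (- (x * x)) (- (x * x)) x≈x² (≈-refl (- (x * x))) ⟩
    x * x - x * x    ≈⟨ pointwise-≈ (x * x - x * x) 0ℝ (λ n → ℚ.+-inverseʳ (seq x n ℚ.* seq x n)) ⟩
    0ℝ               ∎

at-cong : ∀ (k : ArithFun) {a b} .{{_ : NonZero a}} .{{_ : NonZero b}} → a ≡ b → k a ≈ k b
at-cong k {a} {{a≢0}} refl = ≈-refl (k a {{a≢0}})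

-- As 1 is coprime to itself, `g 1` is idempotent; were it 0, it would annihilate every `g x`, since
-- x = 1 · x.
multiplicative-1 : ∀ g → Multiplicative g → g 1 ≈ 1ℝ
multiplicative-1 g g-mult = idempotent-apart-0 (g 1) (mult 1 1 (1-coprimeTo 1)) λ g1≈0 → not-zero λ x →
  let open ℝ-Reasoning in begin-equality
  g x             ≈⟨ at-cong g {{_}} {{ℕ.m*n≢0 1 x}} (sym (ℕ.*-identityˡ x)) ⟩
  g (1 ℕ.* x) {{ℕ.m*n≢0 1 x}}  ≈⟨ mult 1 x (1-coprimeTo x) ⟩
  g 1 * g x       ≈⟨ *-cong (g 1) 0ℝ (g x) (g x) g1≈0 (≈-refl (g x)) ⟩
  0ℝ * g x        ≈⟨ pointwise-≈ (0ℝ * g x) 0ℝ (λ n → ℚ.*-zeroˡ (seq (g x) n)) ⟩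
  0ℝ              ∎
  where open Multiplicative g-mult

-- The exponentials of an additive function and of its negative

exp∘-multiplicative : ∀ f → Additive f → Multiplicative (λ m → exp (f m))
exp∘-multiplicative f f-add = record
  { not-zero = λ exp≈0 → ≤⇒≯ 1ℝ 0ℝ
      (≈⇒≤ 1ℝ 0ℝ (≈-trans 1ℝ (exp (f 1)) 0ℝ (≈-sym (exp (f 1)) 1ℝ exp-f1≈1) (exp≈0 1)))
      (½ , ℚ.positive⁻¹ ½ , 0 , λ _ _ → p<1)
  ; mult = λ x y x⊥y → let open ℝ-Reasoning in begin-equality
      exp (f (x ℕ.* y) {{ℕ.m*n≢0 x y}})
        ≈⟨ exp-cong (f (x ℕ.* y) {{ℕ.m*n≢0 x y}}) (f x + f y) (f-add x y x⊥y) ⟩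
      exp (f x + f y)        ≈⟨ exp-homo-+ (f x) (f y) ⟩
      exp (f x) * exp (f y)  ∎
  }
  where
  p<1 : 0ℚ ℚ.+ ½ ℚ.< 1ℚ
  p<1 = half< (ℚ.positive⁻¹ 1ℚ)
  exp-f1≈1 : exp (f 1) ≈ 1ℝ
  exp-f1≈1 = ≈-trans (exp (f 1)) (exp 0ℝ) 1ℝ (exp-cong (f 1) 0ℝ (additive-1 f f-add)) (exp-0 0ℝ (λ _ → refl))

neg-additive : ∀ f → Additive f → Additive (λ m → - f m)
neg-additive f f-add x y x⊥y = let open ℝ-Reasoning in begin-equality
  - f (x ℕ.* y) {{ℕ.m*n≢0 x y}}  ≈⟨ -‿cong (f (x ℕ.* y) {{ℕ.m*n≢0 x y}}) (f x + f y) (f-add x y x⊥y) ⟩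
  - (f x + f y)                  ≈⟨ pointwise-≈ (- (f x + f y)) (- f x - f y) (λ n → ℚ.neg-distrib-+ (seq (f x) n) (seq (f y) n)) ⟩
  - f x - f y                    ∎

exp∈ℳ : ∀ f → 𝒜 f → ℳ (λ m → exp (f m))
exp∈ℳ f f∈𝒜 = record
  { multiplicative = exp∘-multiplicative f additive
  ; ≥1 = λ x x>1 → 1≤exp (f x) (nonneg x x>1) }
  where open 𝒜 f∈𝒜

exp-neg∈ℐ₀ : ∀ f → 𝒜 f → ℐ₀ (λ m → exp (- f m))
exp-neg∈ℐ₀ f f∈𝒜 = record
  { inℐ = record
    { multiplicative = exp∘-multiplicative (λ m → - f m) (neg-additive f additive)
    ; ≥0 = λ x _ → 0≤exp (- f x)
    ; ≤1 = λ x x>1 → let open ℝ-Reasoning in begin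
        exp (- f x)   ≤⟨ exp-mono-≤ (- f x) (- 0ℝ) (neg-antimono-≤ 0ℝ (f x) (nonneg x x>1)) ⟩
        exp (- 0ℝ)    ≈⟨ exp-0 (- 0ℝ) (λ _ → refl) ⟩
        1ℝ            ∎ }
  ; >0 = λ x _ → 0<exp-neg (f x) }
  where open 𝒜 f∈𝒜

-- The preorders

-- The preorder sees distances from 1 only, so the diagonal convention enters at the single point 1,
-- where the formula gives 0 as well.
offDiagonal-1 : (F : ℤ → ℤ → ℝ) → F (+ 1) (+ 1) ≈ 0ℝ → ∀ x → offDiagonal F (+ 1) x ≈ F (+ 1) x
offDiagonal-1 F F11≈0 x with (+ 1) ℤ.≟ x
... | yes refl = ≈-sym (F (+ 1) (+ 1)) 0ℝ F11≈0
... | no  _    = ≈-refl (F (+ 1) x)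

≤-resp-≈ : ∀ x x′ y y′ → x ≈ x′ → y ≈ y′ → x ≤ y → x′ ≤ y′
≤-resp-≈ x x′ y y′ x≈x′ y≈y′ x≤y = let open ℝ-Reasoning in begin
  x′  ≈⟨ x≈x′ ⟨
  x   ≤⟨ x≤y ⟩
  y   ≈⟨ y≈y′ ⟩
  y′  ∎

⪯⇔≤ : (d : ℤ → ℤ → ℝ) (φ : ℤ → ℝ) → (∀ x → d (+ 1) x ≈ φ x) → ∀ x y → x ⪯[ d ] y ⇔ φ x ≤ φ y
⪯⇔≤ d φ d≈φ x y = mk⇔
  (≤-resp-≈ (d (+ 1) x) (φ x) (d (+ 1) y) (φ y) (d≈φ x) (d≈φ y))
  (≤-resp-≈ (φ x) (d (+ 1) x) (φ y) (d (+ 1) y)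
    (≈-sym (d (+ 1) x) (φ x) (d≈φ x)) (≈-sym (d (+ 1) y) (φ y) (d≈φ y)))

offDiagonal-from-1 : (F : ℤ → ℤ → ℝ) (φ : ℤ → ℝ) → (∀ x → F (+ 1) x ≈ φ x) → φ (+ 1) ≈ 0ℝ → ∀ x → offDiagonal F (+ 1) x ≈ φ x
offDiagonal-from-1 F φ F≈φ φ1≈0 x = ≈-trans (offDiagonal F (+ 1) x) (F (+ 1) x) (φ x)
  (offDiagonal-1 F (≈-trans (F (+ 1) (+ 1)) (φ (+ 1)) 0ℝ (F≈φ (+ 1)) φ1≈0) x) (F≈φ x)

module _ (F : ℤ → ℝ) (F1≈0 : F (+ 1) ≈ 0ℝ) where

  sum-from-1 : ∀ x → offDiagonal (λ x y → F x + F y) (+ 1) x ≈ F x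
  sum-from-1 = offDiagonal-from-1 (λ x y → F x + F y) F
    (λ x → let open ℝ-Reasoning in begin-equality
      F (+ 1) + F x   ≈⟨ +-cong (F (+ 1)) 0ℝ (F x) (F x) F1≈0 (≈-refl (F x)) ⟩
      0ℝ + F x        ≈⟨ pointwise-≈ (0ℝ + F x) (F x) (λ k → ℚ.+-identityˡ (seq (F x) k)) ⟩
      F x             ∎)
    F1≈0

module _ (G : ℤ → ℝ) (G1≈1 : G (+ 1) ≈ 1ℝ) where

  private
    1-G1≈0 : 1ℝ - G (+ 1) ≈ 0ℝ
    1-G1≈0 = +-cong 1ℝ 1ℝ (- G (+ 1)) (- 1ℝ) (≈-refl 1ℝ) (-‿cong (G (+ 1)) 1ℝ G1≈1)

  sum-2-from-1 : ∀ x → offDiagonal (λ x y → G x + G y - 2ℝ) (+ 1) x ≈ G x - 1ℝ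
  sum-2-from-1 = offDiagonal-from-1 (λ x y → G x + G y - 2ℝ) (λ x → G x - 1ℝ)
    (λ x → let open ℝ-Reasoning in begin-equality
      G (+ 1) + G x - 2ℝ
        ≈⟨ +-cong (G (+ 1) + G x) (1ℝ + G x) (- 2ℝ) (- 2ℝ)
             (+-cong (G (+ 1)) 1ℝ (G x) (G x) G1≈1 (≈-refl (G x))) (≈-refl (- 2ℝ)) ⟩
      1ℝ + G x - 2ℝ
        ≈⟨ pointwise-≈ (1ℝ + G x - 2ℝ) (G x - 1ℝ)
             (λ k → solve 1 (λ a → con 1ℚ :+ a :- con (1ℚ ℚ.+ 1ℚ) := a :- con 1ℚ) refl (seq (G x) k)) ⟩
      G x - 1ℝ        ∎)
    (+-cong (G (+ 1)) 1ℝ (- 1ℝ) (- 1ℝ) G1≈1 (≈-refl (- 1ℝ)))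

  2-sum-from-1 : ∀ x → offDiagonal (λ x y → 2ℝ - G x - G y) (+ 1) x ≈ 1ℝ - G x
  2-sum-from-1 = offDiagonal-from-1 (λ x y → 2ℝ - G x - G y) (λ x → 1ℝ - G x)
    (λ x → +-cong (2ℝ - G (+ 1)) 1ℝ (- G x) (- G x)
      (+-cong 2ℝ 2ℝ (- G (+ 1)) (- 1ℝ) (≈-refl 2ℝ) (-‿cong (G (+ 1)) 1ℝ G1≈1)) (≈-refl (- G x)))
    1-G1≈0

  1-product-from-1 : ∀ x → offDiagonal (λ x y → 1ℝ - G x * G y) (+ 1) x ≈ 1ℝ - G x
  1-product-from-1 = offDiagonal-from-1 (λ x y → 1ℝ - G x * G y) (λ x → 1ℝ - G x)
    (λ x → let open ℝ-Reasoning in begin-equality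
      1ℝ - G (+ 1) * G x
        ≈⟨ +-cong 1ℝ 1ℝ (- (G (+ 1) * G x)) (- (1ℝ * G x)) (≈-refl 1ℝ)
             (-‿cong (G (+ 1) * G x) (1ℝ * G x) (*-cong (G (+ 1)) 1ℝ (G x) (G x) G1≈1 (≈-refl (G x)))) ⟩
      1ℝ - 1ℝ * G x
        ≈⟨ pointwise-≈ (1ℝ - 1ℝ * G x) (1ℝ - G x) (λ k → cong (λ a → 1ℚ ℚ.- a) (ℚ.*-identityˡ (seq (G x) k))) ⟩
      1ℝ - G x        ∎)
    1-G1≈0

atGcd-1 : ∀ k n .{{n≢0 : NonZero n}} → atGcd k n (+ 1) ≈ k 1
atGcd-1 k n = at-cong k {{ℕ.≢-nonZero (gcd[m,n]≢0 1 n (inj₂ (ℕ.≢-nonZero⁻¹ n)))}} (gcd-zeroˡ n)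

atGcd-∘ : (e : ℝ → ℝ) (f : ArithFun) (n : ℕ) .{{n≢0 : NonZero n}} → ∀ x →
  atGcd (λ m → e (f m)) n x ≈ e (atGcd f n x)
atGcd-∘ e f n {{n≢0}} x = ≈-refl (e (atGcd f n {{n≢0}} x))

additive-atGcd-1 : ∀ f n .{{n≢0 : NonZero n}} → Additive f → atGcd f n (+ 1) ≈ 0ℝ
additive-atGcd-1 f n {{n≢0}} f-add =
  ≈-trans (atGcd f n {{n≢0}} (+ 1)) (f 1) 0ℝ (atGcd-1 f n {{n≢0}}) (additive-1 f f-add)

multiplicative-atGcd-1 : ∀ g n .{{n≢0 : NonZero n}} → Multiplicative g → atGcd g n (+ 1) ≈ 1ℝ
multiplicative-atGcd-1 g n {{n≢0}} g-mult =
  ≈-trans (atGcd g n {{n≢0}} (+ 1)) (g 1) 1ℝ (atGcd-1 g n {{n≢0}}) (multiplicative-1 g g-mult)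

+-cancelʳ-≤ : ∀ r x y → x + r ≤ y + r → x ≤ y
+-cancelʳ-≤ r x y x+r≤y+r = ≤-resp-≈ (x + r - r) x (y + r - r) y (cancel x) (cancel y)
  (+-mono-≤ (x + r) (y + r) (- r) (- r) x+r≤y+r (≈⇒≤ (- r) (- r) (≈-refl (- r))))
  where
  cancel : ∀ z → z + r - r ≈ z
  cancel z = pointwise-≈ (z + r - r) z (λ n → solve 2 (λ a b → a :+ b :- b := a) refl (seq z n) (seq r n))

≤⇔exp-1≤ : ∀ x y → x ≤ y ⇔ exp x - 1ℝ ≤ exp y - 1ℝ
≤⇔exp-1≤ x y = mk⇔
  (λ x≤y → +-mono-≤ (exp x) (exp y) (- 1ℝ) (- 1ℝ) (exp-mono-≤ x y x≤y) (≈⇒≤ (- 1ℝ) (- 1ℝ) (≈-refl (- 1ℝ))))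
  (λ le → exp-cancel-≤ x y (+-cancelʳ-≤ (- 1ℝ) (exp x) (exp y) le))

1-‿antimono-≤ : ∀ x y → x ≤ y → 1ℝ - y ≤ 1ℝ - x
1-‿antimono-≤ x y x≤y = +-mono-≤ 1ℝ 1ℝ (- y) (- x) (≈⇒≤ 1ℝ 1ℝ (≈-refl 1ℝ)) (neg-antimono-≤ x y x≤y)

-- The increasing `exp` stands between two order reversals, negation and `1ℝ - z`. Both are
-- involutions, so the converse applies them once more.
≤⇔1-exp-neg≤ : ∀ x y → x ≤ y ⇔ 1ℝ - exp (- x) ≤ 1ℝ - exp (- y)
≤⇔1-exp-neg≤ x y = mk⇔
  (λ x≤y → 1-‿antimono-≤ (exp (- y)) (exp (- x)) (exp-mono-≤ (- y) (- x) (neg-antimono-≤ x y x≤y)))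
  (λ le → ≤-resp-≈ (- (- x)) x (- (- y)) y (neg-involutive x) (neg-involutive y)
    (neg-antimono-≤ (- y) (- x) (exp-cancel-≤ (- y) (- x)
      (≤-resp-≈ (1ℝ - (1ℝ - exp (- y))) (exp (- y)) (1ℝ - (1ℝ - exp (- x))) (exp (- x))
        (1-‿involutive (exp (- y))) (1-‿involutive (exp (- x)))
        (1-‿antimono-≤ (1ℝ - exp (- x)) (1ℝ - exp (- y)) le)))))
  where
  neg-involutive : ∀ z → - (- z) ≈ z
  neg-involutive z = pointwise-≈ (- (- z)) z (λ n → solve 1 (λ a → :- (:- a) := a) refl (seq z n))
  1-‿involutive : ∀ z → 1ℝ - (1ℝ - z) ≈ z
  1-‿involutive z = pointwise-≈ (1ℝ - (1ℝ - z)) z (λ n → solve 1 (λ a → con 1ℚ :- (con 1ℚ :- a) := a) refl (seq z n))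

-- Both distances from 1 equal `1ℝ - H z`. No logarithm of `H` is involved, so functions in `ℐ`
-- outside `ℐ₀` are covered too.
2-sum⇔1-product : (H : ℤ → ℝ) → H (+ 1) ≈ 1ℝ → ∀ x y →
  x ⪯[ offDiagonal (λ x y → 2ℝ - H x - H y) ] y ⇔ x ⪯[ offDiagonal (λ x y → 1ℝ - H x * H y) ] y
2-sum⇔1-product H H1≈1 x y = ⇔.trans
  (⪯⇔≤ (offDiagonal (λ x y → 2ℝ - H x - H y)) (λ z → 1ℝ - H z) (2-sum-from-1 H H1≈1) x y)
  (⇔.sym (⪯⇔≤ (offDiagonal (λ x y → 1ℝ - H x * H y)) (λ z → 1ℝ - H z) (1-product-from-1 H H1≈1) x y))

module _ (F : ℤ → ℝ) (F1≈0 : F (+ 1) ≈ 0ℝ) where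

  sum⇔≤ : ∀ x y → x ⪯[ offDiagonal (λ x y → F x + F y) ] y ⇔ F x ≤ F y
  sum⇔≤ = ⪯⇔≤ (offDiagonal (λ x y → F x + F y)) F (sum-from-1 F F1≈0)

  sum-2⇔≤ : (G : ℤ → ℝ) → (∀ x → G x ≈ exp (F x)) → G (+ 1) ≈ 1ℝ → ∀ x y →
    x ⪯[ offDiagonal (λ x y → G x + G y - 2ℝ) ] y ⇔ F x ≤ F y
  sum-2⇔≤ G G≈exp G1≈1 x y = ⇔.trans
    (⪯⇔≤ (offDiagonal (λ x y → G x + G y - 2ℝ)) (λ z → exp (F z) - 1ℝ)
      (λ z → ≈-trans (offDiagonal (λ x y → G x + G y - 2ℝ) (+ 1) z) (G z - 1ℝ) (exp (F z) - 1ℝ)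
        (sum-2-from-1 G G1≈1 z) (+-cong (G z) (exp (F z)) (- 1ℝ) (- 1ℝ) (G≈exp z) (≈-refl (- 1ℝ)))) x y)
    (⇔.sym (≤⇔exp-1≤ (F x) (F y)))

  2-sum⇔≤ : (H : ℤ → ℝ) → (∀ x → H x ≈ exp (- F x)) → H (+ 1) ≈ 1ℝ → ∀ x y →
    x ⪯[ offDiagonal (λ x y → 2ℝ - H x - H y) ] y ⇔ F x ≤ F y
  2-sum⇔≤ H H≈exp H1≈1 x y = ⇔.trans
    (⪯⇔≤ (offDiagonal (λ x y → 2ℝ - H x - H y)) (λ z → 1ℝ - exp (- F z))
      (λ z → ≈-trans (offDiagonal (λ x y → 2ℝ - H x - H y) (+ 1) z) (1ℝ - H z) (1ℝ - exp (- F z))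
        (2-sum-from-1 H H1≈1 z)
        (+-cong 1ℝ 1ℝ (- H z) (- exp (- F z)) (≈-refl 1ℝ) (-‿cong (H z) (exp (- F z)) (H≈exp z)))) x y)
    (⇔.sym (≤⇔1-exp-neg≤ (F x) (F y)))

-- The instances are given explicitly: if one is still unsolved when two reals
-- are compared, Agda goes on to compare the proofs in their cauchy components.
module _ (n : ℕ) .{{n≢0 : NonZero n}} where

  d𝒜+⇔≤ : ∀ f → Additive f → ∀ x y → x ⪯[ d𝒜+ n f ] y ⇔ atGcd f n x ≤ atGcd f n y
  d𝒜+⇔≤ f f-add = sum⇔≤ (atGcd f n {{n≢0}}) (additive-atGcd-1 f n {{n≢0}} f-add)

  dℳ+⇔≤ : ∀ f g → Additive f → Multiplicative g → (∀ x → atGcd g n x ≈ exp (atGcd f n x)) →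
    ∀ x y → x ⪯[ dℳ+ n g ] y ⇔ atGcd f n x ≤ atGcd f n y
  dℳ+⇔≤ f g f-add g-mult g≈exp = sum-2⇔≤ (atGcd f n {{n≢0}}) (additive-atGcd-1 f n {{n≢0}} f-add)
    (atGcd g n {{n≢0}}) g≈exp (multiplicative-atGcd-1 g n {{n≢0}} g-mult)

  dℐ+⇔≤ : ∀ f h → Additive f → Multiplicative h → (∀ x → atGcd h n x ≈ exp (- atGcd f n x)) →
    ∀ x y → x ⪯[ dℐ+ n h ] y ⇔ atGcd f n x ≤ atGcd f n y
  dℐ+⇔≤ f h f-add h-mult h≈exp = 2-sum⇔≤ (atGcd f n {{n≢0}}) (additive-atGcd-1 f n {{n≢0}} f-add)
    (atGcd h n {{n≢0}}) h≈exp (multiplicative-atGcd-1 h n {{n≢0}} h-mult)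

  dℐ+⇔dℐ· : ∀ h → Multiplicative h → ∀ x y → x ⪯[ dℐ+ n h ] y ⇔ x ⪯[ dℐ· n h ] y
  dℐ+⇔dℐ· h h-mult = 2-sum⇔1-product (atGcd h n {{n≢0}}) (multiplicative-atGcd-1 h n {{n≢0}} h-mult)

theorem4p1 : (n : ℕ) .{{_ : NonZero n}} → n > 1 →
    ((f : ArithFun) → 𝒜 f →
      let g : ArithFun
          g = λ m → exp (f m)
          h : ArithFun
          h = λ m → exp (- f m)
      in ℳ g × ℐ₀ h ×
         ((x y : ℤ) →
           (x ⪯[ d𝒜+ n f ] y ⇔ x ⪯[ dℳ+ n g ] y) ×
           (x ⪯[ dℳ+ n g ] y ⇔ x ⪯[ dℐ+ n h ] y) ×
           (x ⪯[ dℐ+ n h ] y ⇔ x ⪯[ dℐ· n h ] y)))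
    ×
    ((h₀ : ArithFun) → ℐ h₀ → ¬ ℐ₀ h₀ →
      (x y : ℤ) → x ⪯[ dℐ+ n h₀ ] y ⇔ x ⪯[ dℐ· n h₀ ] y)
theorem4p1 n {{n≢0}} _ =
  (λ f f∈𝒜 →
    let f-add = 𝒜.additive f∈𝒜
        g : ArithFun
        g = λ m {{m≢0}} → exp (f m {{m≢0}})
        h : ArithFun
        h = λ m {{m≢0}} → exp (- f m {{m≢0}})
        g∈ℳ = exp∈ℳ f f∈𝒜
        h∈ℐ₀ = exp-neg∈ℐ₀ f f∈𝒜
        h-mult = ℐ.multiplicative (ℐ₀.inℐ h∈ℐ₀)
        f⇔ = d𝒜+⇔≤ n {{n≢0}} f f-add
        g⇔ = dℳ+⇔≤ n {{n≢0}} f g f-add (ℳ.multiplicative g∈ℳ) (atGcd-∘ exp f n {{n≢0}})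
        h⇔ = dℐ+⇔≤ n {{n≢0}} f h f-add h-mult (atGcd-∘ (λ r → exp (- r)) f n {{n≢0}})
    in g∈ℳ , h∈ℐ₀ , λ x y →
      ⇔.trans (f⇔ x y) (⇔.sym (g⇔ x y)) ,
      ⇔.trans (g⇔ x y) (⇔.sym (h⇔ x y)) ,
      dℐ+⇔dℐ· n {{n≢0}} h h-mult x y) ,
  λ h₀ h₀∈ℐ _ → dℐ+⇔dℐ· n {{n≢0}} h₀ (ℐ.multiplicative h₀∈ℐ)
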